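{- Let $p\ge5$ be prime. For $k\ge1$ and arbitrary $A,B\in\mathbb{Z}$, put \[ t=\min\left(\left\lfloor\frac{v_p(A)}4\right\rfloor,\left\lfloor\frac{v_p(B)}6\right\rfloor,\left\lfloor\frac{k}6\right\rfloor\right),\quad \ell=k-6t,\quad A_t=A/p^{4t},\quad B_t=B/p^{6t}. \] Then \[ N_k(A,B)=p^{k-1}(p^t-1)+p^{7t}N_\ell(A_t,B_t). \] Moreover, the count on the right is evaluated without another scaling step: if $\ell=0$ it is $1$; if $1\le\ell<6$, then the pair $(A_t,B_t)$ either falls in one of the cases good reduction, node, or terminal cusp, or satisfies $p^4\mid A_t$ and $p^6\mid B_t$, in which case $N_\ell(A_t,B_t)$ is a base value; and if $\ell\ge6$, then $p^4\nmid A_t$ or $p^6\nmid B_t$, so that a scaling step cannot apply and $(A_t,B_t)$ falls in one of the cases good reduction, node, or terminal cusp.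
   Context: $v_p$ is the $p$-adic valuation with $v_p(0)=\infty$, and $\lfloor\infty\rfloor=\infty$ (so $t$ is always finite). For $a,b\in\mathbb{Z}$ and $j\ge1$, $N_j(a,b)=\#\{(x,y)\in(\mathbb{Z}/p^j\mathbb{Z})^2 : y^2\equiv x^3+ax+b\pmod{p^j}\}$, and $N_0(a,b)=1$. Terminology for a pair $(a,b)$ of integers, with $D=4a^3+27b^2$: good reduction means $p\nmid D$; node means $p\mid D$ and $p\nmid a$; terminal cusp means $p\mid a$, $p\mid b$ and not both $v_p(a)\ge4$ and $v_p(b)\ge6$. A scaling step is the identity $N_k(a,b)=(p-1)p^{k-1}+p^7N_{k-6}(a/p^4,b/p^6)$, which is available when $k\ge6$, $p^4\mid a$ and $p^6\mid b$. The base values, for $p^4\mid a$, $p^6\mid b$ and $1\le j<6$, are $N_j(a,b)=(p-1)p^{j-1}+M_j$ with $M_1=1$ and $M_j=p^j$ for $2\le j<6$. -}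

module Defs where

open import Data.Fin using (Fin; toℕ)
open import Data.Integer as ℤ using (ℤ; +_; -[1+_]; _+_; _-_; _*_; _^_)
open import Data.Integer.Divisibility.Signed using (_∣_; _∣?_; divides; quotient; ∣ᵤ⇒∣; ∣-trans)
open import Data.Integer.Properties as ℤ using ()
open import Data.List using (length; filter; allFin; cartesianProduct)
open import Data.Nat as ℕ using (ℕ; zero; suc; _≤_; _∸_; _⊓_; _/_)
open import Data.Nat.Divisibility as ℕ using (m∣m*n)
open import Data.Nat.DivMod using (m/n*n≤m)
open import Data.Nat.Properties as ℕ using ()
open import Data.Product using (_×_; _,_)
open import Data.Sum using (_⊎_)
open import Relation.Binary.Construct.Add.Supremum.NonStrict _≤_ using (_≤⁺_; [_]; _≤⊤⁺; ≤⁺-trans)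
open import Relation.Binary.PropositionalEquality using (_≡_; refl; sym; trans; cong; subst)
open import Relation.Nullary using (¬_; Dec; yes; no)
open import Relation.Nullary.Construct.Add.Supremum using (_⁺; ⊤⁺; [_])

ℕ∞ : Set
ℕ∞ = ℕ ⁺

⌊_/_⌋ : ℕ∞ → (d : ℕ) .{{_ : ℕ.NonZero d}} → ℕ∞
⌊ ⊤⁺    / d ⌋ = ⊤⁺
⌊ [ m ] / d ⌋ = [ m / d ]

infixr 7 _⊓∞_

_⊓∞_ : ℕ∞ → ℕ → ℕ
⊤⁺    ⊓∞ n = n
[ m ] ⊓∞ n = m ⊓ n

-- The largest e ≤ bound with pᵉ ∣ n.
maxPower : (p : ℕ) (n : ℤ) (bound : ℕ) → ℕ
maxPower p n zero    = zero
maxPower p n (suc e) with + (p ℕ.^ suc e) ∣? n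
... | yes _ = suc e
... | no  _ = maxPower p n e

-- For n ≢ 0 and p ≥ 2, pᵉ ∣ n forces e < pᵉ ≤ ∣ n ∣, so the bound ∣ n ∣ loses nothing.
v : ℕ → ℤ → ℕ∞
v p (+ zero) = ⊤⁺
v p n@(+ suc _) = [ maxPower p n ℤ.∣ n ∣ ]
v p n@(-[1+ _ ]) = [ maxPower p n ℤ.∣ n ∣ ]

-- Residues modulo m are represented by Fin m; the congruence is independent of
-- the representatives.
OnCurve : (m : ℕ) (a b : ℤ) → Fin m × Fin m → Set
OnCurve m a b (i , j) = let x = + toℕ i; y = + toℕ j in
  + m ∣ (y ^ 2 - (x ^ 3 + a * x + b))

onCurve? : ∀ m a b (P : Fin m × Fin m) → Dec (OnCurve m a b P)
onCurve? m a b (i , j) = + m ∣? _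

N : (p j : ℕ) (a b : ℤ) → ℕ
N p zero      a b = 1
N p j@(suc _) a b = length (filter (onCurve? m a b) (cartesianProduct (allFin m) (allFin m)))
  where m = p ℕ.^ j

D : ℤ → ℤ → ℤ
D a b = + 4 * a ^ 3 + + 27 * b ^ 2

GoodReduction : ℕ → ℤ → ℤ → Set
GoodReduction p a b = ¬ (+ p ∣ D a b)

Node : ℕ → ℤ → ℤ → Set
Node p a b = + p ∣ D a b × ¬ (+ p ∣ a)

TerminalCusp : ℕ → ℤ → ℤ → Set
TerminalCusp p a b = + p ∣ a × + p ∣ b × ¬ ([ 4 ] ≤⁺ v p a × [ 6 ] ≤⁺ v p b)

TerminalCase : ℕ → ℤ → ℤ → Set
TerminalCase p a b = GoodReduction p a b ⊎ Node p a b ⊎ TerminalCusp p a b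

ScalingAvailable : (p k : ℕ) (a b : ℤ) → Set
ScalingAvailable p k a b = 6 ≤ k × + (p ℕ.^ 4) ∣ a × + (p ℕ.^ 6) ∣ b

-- M and baseValue are meaningful only for 1 ≤ j < 6.
M : (p j : ℕ) → ℕ
M p 1 = 1
M p j = p ℕ.^ j

baseValue : (p j : ℕ) → ℕ
baseValue p j = (p ∸ 1) ℕ.* p ℕ.^ (j ∸ 1) ℕ.+ M p j

scalingDepth : (p k : ℕ) (A B : ℤ) → ℕ
scalingDepth p k A B = ⌊ v p A / 4 ⌋ ⊓∞ ⌊ v p B / 6 ⌋ ⊓∞ (k / 6)

^-∣ : ∀ p {d e} → d ≤ e → + (p ℕ.^ d) ∣ + (p ℕ.^ e)
^-∣ p {d} {e} d≤e = ∣ᵤ⇒∣ (subst (p ℕ.^ d ℕ.∣_) eq (m∣m*n (p ℕ.^ (e ∸ d))))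
  where
  eq : p ℕ.^ d ℕ.* p ℕ.^ (e ∸ d) ≡ p ℕ.^ e
  eq = trans (sym (ℕ.^-distribˡ-+-* p d (e ∸ d))) (cong (p ℕ.^_) (ℕ.m+[n∸m]≡n d≤e))

maxPower-∣ : ∀ p n bound → + (p ℕ.^ maxPower p n bound) ∣ n
maxPower-∣ p n zero    = divides n (sym (ℤ.*-identityʳ n))
maxPower-∣ p n (suc e) with + (p ℕ.^ suc e) ∣? n
... | yes pᵉ∣n = pᵉ∣n
... | no  _    = maxPower-∣ p n e

^-∣-maxPower : ∀ p n bound d .{{_ : ℕ.NonZero d}} {t} →
               t ≤ maxPower p n bound / d → + (p ℕ.^ (d ℕ.* t)) ∣ n
^-∣-maxPower p n bound d {t} t≤ = ∣-trans (^-∣ p dt≤) (maxPower-∣ p n bound)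
  where
  open ℕ.≤-Reasoning
  dt≤ : d ℕ.* t ≤ maxPower p n bound
  dt≤ = begin
    d ℕ.* t                          ≡⟨ ℕ.*-comm d t ⟩
    t ℕ.* d                          ≤⟨ ℕ.*-monoˡ-≤ d t≤ ⟩
    (maxPower p n bound / d) ℕ.* d   ≤⟨ m/n*n≤m (maxPower p n bound) d ⟩
    maxPower p n bound               ∎

^-∣-floor : ∀ p n d .{{_ : ℕ.NonZero d}} {t} →
            [ t ] ≤⁺ ⌊ v p n / d ⌋ → + (p ℕ.^ (d ℕ.* t)) ∣ n
^-∣-floor p (+ zero)     d _      = divides (+ 0) refl
^-∣-floor p n@(+ suc _)  d [ t≤ ] = ^-∣-maxPower p n ℤ.∣ n ∣ d t≤
^-∣-floor p n@(-[1+ _ ]) d [ t≤ ] = ^-∣-maxPower p n ℤ.∣ n ∣ d t≤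

⊓∞-≤ˡ : ∀ m n → [ m ⊓∞ n ] ≤⁺ m
⊓∞-≤ˡ ⊤⁺    n = _ ≤⊤⁺
⊓∞-≤ˡ [ m ] n = [ ℕ.m⊓n≤m m n ]

⊓∞-≤ʳ : ∀ m n → m ⊓∞ n ≤ n
⊓∞-≤ʳ ⊤⁺    n = ℕ.≤-refl
⊓∞-≤ʳ [ m ] n = ℕ.m⊓n≤n m n

p⁴ᵗ∣A : ∀ p k A B → + (p ℕ.^ (4 ℕ.* scalingDepth p k A B)) ∣ A
p⁴ᵗ∣A p k A B = ^-∣-floor p A 4 (⊓∞-≤ˡ ⌊ v p A / 4 ⌋ (⌊ v p B / 6 ⌋ ⊓∞ (k / 6)))

p⁶ᵗ∣B : ∀ p k A B → + (p ℕ.^ (6 ℕ.* scalingDepth p k A B)) ∣ B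
p⁶ᵗ∣B p k A B = ^-∣-floor p B 6
  (≤⁺-trans ℕ.≤-trans [ ⊓∞-≤ʳ ⌊ v p A / 4 ⌋ _ ] (⊓∞-≤ˡ ⌊ v p B / 6 ⌋ (k / 6)))

-- The exact quotients A / p⁴ᵗ and B / p⁶ᵗ with t = scalingDepth p k A B.
scaledA scaledB : (p k : ℕ) (A B : ℤ) → ℤ
scaledA p k A B = quotient (p⁴ᵗ∣A p k A B)
scaledB p k A B = quotient (p⁶ᵗ∣B p k A B)

-- The truncated subtraction k ∸ 6 * t is exact.
6*t≤k : ∀ p k A B → 6 ℕ.* scalingDepth p k A B ≤ k
6*t≤k p k A B = begin
  6 ℕ.* t       ≡⟨ ℕ.*-comm 6 t ⟩
  t ℕ.* 6       ≤⟨ ℕ.*-monoˡ-≤ 6 (ℕ.≤-trans (⊓∞-≤ʳ ⌊ v p A / 4 ⌋ _) (⊓∞-≤ʳ ⌊ v p B / 6 ⌋ _)) ⟩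
  k / 6 ℕ.* 6   ≤⟨ m/n*n≤m k 6 ⟩
  k             ∎
  where
  open ℕ.≤-Reasoning
  t = scalingDepth p k A B

{-# OPTIONS --safe #-}
-- Split the points modulo pᵏ according to whether p ∣ x, where p⁴ ∣ a and p⁶ ∣ b.  Modulo p the
-- points with p ∤ x are (t², t³) with t ≢ 0, and each lifts by Hensel's lemma in y, giving
-- (p − 1) pᵏ⁻¹.  If p ∣ x, comparing valuations in y² ≡ x³ + a x + b gives in turn
-- p ∣ y, p² ∣ y, p² ∣ x, p³ ∣ y as far as k allows; for k ≥ 6 the substitution x = p² X, y = p³ Y
-- leaves the curve (a / p⁴, b / p⁶) modulo pᵏ⁻⁶, every point of which is counted p⁴ p³ times.
-- Iterating this step t times sums a geometric series, and the maximality of t forbids another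
-- step while ℓ ≥ 6.

module Submission where

open import Defs
open import Data.Integer using (ℤ; +_)
open import Data.Integer.Divisibility.Signed using (_∣_)
open import Data.Nat using (ℕ; _+_; _*_; _∸_; _^_; _≤_; _<_)
open import Data.Nat.Primality using (Prime)
open import Data.Product using (_×_)
open import Data.Sum using (_⊎_)
open import Relation.Binary.PropositionalEquality using (_≡_)
open import Relation.Nullary using (¬_)

open import Data.Bool using (true; false; if_then_else_)
open import Data.Fin using (Fin; zero; suc; toℕ)
open import Data.Fin.Properties using (toℕ<n)
open import Data.Integer as ℤ using (-[1+_])
import Data.Integer.Properties as ℤ
open import Data.Integer.Divisibility.Signed using (_∣?_; divides; ∣ᵤ⇒∣; ∣⇒∣ᵤ; ∣-trans;
  ∣-refl; m∣∣m∣; ∣m∣n⇒∣m+n; ∣m∣n⇒∣m-n; ∣m+n∣m⇒∣n; ∣m+n∣n⇒∣m; ∣m⇒∣-m; ∣m⇒∣m*n; ∣n⇒∣m*n; *-monoˡ-∣; *-cancelʳ-∣)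
open import Data.Integer.DivMod using (n%ℕd<d; a≡a%ℕn+[a/ℕn]*n)
open import Data.Integer.Solver using (module +-*-Solver)
open import Data.List using (length; filter; map; tabulate; cartesianProduct)
open import Data.List.Properties using (length-++; filter-++; map-tabulate)
open import Data.Nat as ℕ using (zero; suc; NonZero; z≤n; s≤s; _/_)
import Data.Nat.Properties as ℕ
import Data.Nat.Solver as ℕ-Solver
import Data.Nat.Divisibility as ℕ
open import Data.Nat.DivMod using (/-monoˡ-≤; m*n/n≡m)
open import Data.Nat.GCD using (module Bézout)
open import Data.Nat.Coprimality using (coprime-Bézout)
open import Data.Nat.Primality using (euclidsLemma; prime⇒nonZero; prime⇒irreducible)
open import Data.Product using (_,_; proj₁; proj₂; ∃)
open import Data.Sum using (inj₁; inj₂; [_,_]′; map₂)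
open import Function using (_∘_; id; mk⇔)
open import Relation.Binary.PropositionalEquality
  using (refl; sym; trans; cong; cong₂; subst; subst₂; _≢_; module ≡-Reasoning)
open import Relation.Binary.Construct.Add.Supremum.NonStrict _≤_ using (_≤⁺_; [_]; _≤⊤⁺)
open import Relation.Nullary.Construct.Add.Supremum using ([_])
open import Relation.Nullary using (Dec; yes; no; does; contradiction; ¬?; _×-dec_)
open import Relation.Nullary.Decidable using (True; toWitness; dec-true; dec-false; does-⇔)
open import Algebra.Properties.Semiring.Sum ℕ.+-*-semiring
  using (sum; sum-cong-≗; sum-replicate-zero; ∑-distrib-+; ∑-comm; *-distribˡ-sum)

open +-*-Solver using (solve; _:=_; _:+_; _:*_; _:-_; _:^_; :-_; con; Polynomial)
open ℕ-Solver.+-*-Solver using ()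
  renaming (solve to solveℕ; _:=_ to _⊜_; _:+_ to _⊕_; _:*_ to _⊗_; con to conℕ)

-- No bijection between point sets is ever constructed. Counts are double sums of 0/1 indicators
-- over initial ranges of naturals, and each bijective step becomes a manipulation of sums: a
-- variable determined uniquely by the others is summed in or out, and the order of summation is
-- exchanged.
--
-- All uniqueness comes from linear congruences modulo the prime itself. Higher powers are reached
-- one factor of `p` at a time, so inverses are taken modulo `p` only.
--
-- The bound on `p` makes two constants units: 2, for the `y`-derivative `2y` in the lifting
-- argument, and 27, for deducing `p ∣ b` from `p ∣ D a b` and `p ∣ a`.

private variable
  p : ℕ
  P Q : Set

-- Finite sums and counting

∑ : ℕ → (ℕ → ℕ) → ℕ
∑ n f = sum {n} (f ∘ toℕ)

∑-cong : ∀ n {f g : ℕ → ℕ} → (∀ i → i < n → f i ≡ g i) → ∑ n f ≡ ∑ n g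
∑-cong n f≗g = sum-cong-≗ {n} (λ i → f≗g (toℕ i) (toℕ<n i))

∑-zero : ∀ n {f : ℕ → ℕ} → (∀ i → i < n → f i ≡ 0) → ∑ n f ≡ 0
∑-zero n f≗0 = trans (∑-cong n f≗0) (sum-replicate-zero n)

∑-const : ∀ n c → ∑ n (λ _ → c) ≡ n * c
∑-const zero    c = refl
∑-const (suc n) c = cong (_+_ c) (∑-const n c)

∑-++ : ∀ m n f → ∑ (m + n) f ≡ ∑ m f + ∑ n (λ i → f (m + i))
∑-++ zero    n f = refl
∑-++ (suc m) n f = trans (cong (_+_ (f 0)) (∑-++ m n (f ∘ suc))) (sym (ℕ.+-assoc (f 0) _ _))

∑-swap : ∀ m n (f : ℕ → ℕ → ℕ) → ∑ m (λ i → ∑ n (f i)) ≡ ∑ n (λ j → ∑ m (λ i → f i j))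
∑-swap m n f = ∑-comm {m} {n} (λ i j → f (toℕ i) (toℕ j))

∑-block : ∀ m n f → ∑ (m * n) f ≡ ∑ m (λ q → ∑ n (λ r → f (q * n + r)))
∑-block zero    n f = refl
∑-block (suc m) n f = trans (∑-++ n (m * n) f) (cong (_+_ (∑ n f)) (begin
  ∑ (m * n) (λ i → f (n + i))                       ≡⟨ ∑-block m n (λ i → f (n + i)) ⟩
  ∑ m (λ q → ∑ n (λ r → f (n + (q * n + r))))  ≡⟨ ∑-cong m (λ q _ → ∑-cong n (λ r _ → cong f (sym (ℕ.+-assoc n (q * n) r)))) ⟩
  ∑ m (λ q → ∑ n (λ r → f (n + q * n + r)))    ∎))
  where open ≡-Reasoning

∑-periodic : ∀ m n f → (∀ q r → f (q * n + r) ≡ f r) → ∑ (m * n) f ≡ m * ∑ n f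
∑-periodic m n f per = begin
  ∑ (m * n) f                              ≡⟨ ∑-block m n f ⟩
  ∑ m (λ q → ∑ n (λ r → f (q * n + r)))  ≡⟨ ∑-cong m (λ q _ → ∑-cong n (λ r _ → per q r)) ⟩
  ∑ m (λ _ → ∑ n f)                       ≡⟨ ∑-const m _ ⟩
  m * ∑ n f                                ∎
  where open ≡-Reasoning

-- The substitution `i = q * n` inside a count: each block of length `n` begins at a multiple of
-- `n`, and its other entries vanish.
∑-multiples : ∀ m n .{{_ : NonZero n}} f → (∀ i → ¬ n ℕ.∣ i → f i ≡ 0) →
              ∑ (m * n) f ≡ ∑ m (λ q → f (q * n))
∑-multiples m n@(suc n-1) f vanish = trans (∑-block m n f) (∑-cong m λ q _ → begin
  f (q * n + 0) + ∑ n-1 (λ r → f (q * n + suc r)) ≡⟨ cong₂ _+_ (cong f (ℕ.+-identityʳ _)) (∑-zero n-1 (offset q)) ⟩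
  f (q * n) + 0                                   ≡⟨ ℕ.+-identityʳ _ ⟩
  f (q * n)                                       ∎)
  where
  open ≡-Reasoning
  offset : ∀ q r → r < n-1 → f (q * n + suc r) ≡ 0
  offset q r r<n-1 = vanish _ λ n∣ →
    ℕ.<⇒≱ (s≤s r<n-1) (ℕ.∣⇒≤ (ℕ.∣m+n∣m⇒∣n n∣ (ℕ.n∣m*n q)))

∑-unique : ∀ n {f : ℕ → ℕ} u → u < n → f u ≡ 1 → (∀ i → i < n → i ≢ u → f i ≡ 0) → ∑ n f ≡ 1
∑-unique (suc n) zero    _         fu≡1 others =
  cong₂ _+_ fu≡1 (∑-zero n (λ i i<n → others (suc i) (s≤s i<n) λ ()))
∑-unique (suc n) (suc u) (s≤s u<n) fu≡1 others =
  cong₂ _+_ (others 0 (s≤s z≤n) λ ())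
    (∑-unique n u u<n fu≡1 (λ i i<n i≢u → others (suc i) (s≤s i<n) (i≢u ∘ ℕ.suc-injective)))

∑∑-multiples : ∀ {k l} m n s t .{{_ : NonZero s}} .{{_ : NonZero t}} (f : ℕ → ℕ → ℕ) →
               k ≡ m * s → l ≡ n * t → (∀ x y → ¬ (s ℕ.∣ x × t ℕ.∣ y) → f x y ≡ 0) →
               ∑ k (λ x → ∑ l (f x)) ≡ ∑ m (λ x → ∑ n (λ y → f (x * s) (y * t)))
∑∑-multiples m n s t f refl refl vanish = trans
  (∑-multiples m s _ (λ x s∤x → ∑-zero (n * t) (λ y _ → vanish x y (s∤x ∘ proj₁))))
  (∑-cong m (λ x _ → ∑-multiples n t _ (λ y t∤y → vanish (x * s) y (t∤y ∘ proj₂))))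

-- The Iverson bracket. It branches on `does` alone, as `filter` does, so equivalent propositions
-- get equal values whatever their decision procedures are.
⟦_⟧ : Dec P → ℕ
⟦ P? ⟧ = if does P? then 1 else 0

⟦⟧-cong : (P → Q) → (Q → P) → (P? : Dec P) (Q? : Dec Q) → ⟦ P? ⟧ ≡ ⟦ Q? ⟧
⟦⟧-cong to from P? Q? = cong (if_then 1 else 0) (does-⇔ (mk⇔ to from) P? Q?)

⟦⟧-true : (P? : Dec P) → P → ⟦ P? ⟧ ≡ 1
⟦⟧-true P? p = cong (if_then 1 else 0) (dec-true P? p)

⟦⟧-false : (P? : Dec P) → ¬ P → ⟦ P? ⟧ ≡ 0
⟦⟧-false P? ¬p = cong (if_then 1 else 0) (dec-false P? ¬p)

⟦⟧-split : (P? : Dec P) (Q? : Dec Q) → ⟦ Q? ⟧ ≡ ⟦ ¬? P? ×-dec Q? ⟧ + ⟦ P? ×-dec Q? ⟧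
⟦⟧-split P? Q? with does P? | does Q?
... | true  | true  = refl
... | true  | false = refl
... | false | true  = refl
... | false | false = refl

module _ {A : Set} {R : A → Set} (R? : ∀ x → Dec (R x)) where

  length-filter-tabulate : ∀ {n} (f : Fin n → A) →
                           length (filter R? (tabulate f)) ≡ sum (λ i → ⟦ R? (f i) ⟧)
  length-filter-tabulate {zero}  f = refl
  length-filter-tabulate {suc n} f with does (R? (f zero))
  ... | true  = cong suc (length-filter-tabulate (f ∘ suc))
  ... | false = length-filter-tabulate (f ∘ suc)

length-filter-cartesianProduct :
  ∀ {A B : Set} {R : A × B → Set} (R? : ∀ x → Dec (R x)) {m n} (f : Fin m → A) (g : Fin n → B) →
  length (filter R? (cartesianProduct (tabulate f) (tabulate g))) ≡ sum (λ i → sum (λ j → ⟦ R? (f i , g j) ⟧))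
length-filter-cartesianProduct R? {zero}  f g = refl
length-filter-cartesianProduct R? {suc m} f g = begin
  length (filter R? (row ++ rows))                   ≡⟨ cong length (filter-++ R? row rows) ⟩
  length (filter R? row ++ filter R? rows)           ≡⟨ length-++ (filter R? row) ⟩
  length (filter R? row) + length (filter R? rows)   ≡⟨ cong₂ _+_ row-count (length-filter-cartesianProduct R? (f ∘ suc) g) ⟩
  _                                                  ∎
  where
  open ≡-Reasoning
  open Data.List using (_++_)
  row  = map (f zero ,_) (tabulate g)
  rows = cartesianProduct (tabulate (f ∘ suc)) (tabulate g)
  row-count : length (filter R? row) ≡ sum (λ j → ⟦ R? (f zero , g j) ⟧)
  row-count = trans (cong (length ∘ filter R?) (map-tabulate g (f zero ,_)))
                    (length-filter-tabulate R? (λ j → f zero , g j))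

-- The curve and congruences modulo p

F : ℤ → ℤ → ℤ → ℤ → ℤ
F a b x y = y ℤ.^ 2 ℤ.- (x ℤ.^ 3 ℤ.+ a ℤ.* x ℤ.+ b)

1∣ : ∀ n → + 1 ∣ n
1∣ n = divides n (sym (ℤ.*-identityʳ n))

-- At `j = 0` the value 1 fixed by definition agrees with the sum, since 1 divides everything. The
-- scaling step can therefore land on exponent 0 like on any other.
N-∑ : ∀ p j a b → N p j a b ≡ ∑ (p ^ j) (λ x → ∑ (p ^ j) (λ y → ⟦ + (p ^ j) ∣? F a b (+ x) (+ y) ⟧))
N-∑ p zero      a b = sym (cong (λ n → n + 0 + 0) (⟦⟧-true (+ 1 ∣? F a b (+ 0) (+ 0)) (1∣ _)))
N-∑ p j@(suc _) a b = length-filter-cartesianProduct (onCurve? (p ^ j) a b) id id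

:F : ∀ {n} → (a b x y : Polynomial n) → Polynomial n
:F a b x y = y :^ 2 :- (x :^ 3 :+ a :* x :+ b)

pos-*+ : ∀ q n r → + (q * n + r) ≡ + q ℤ.* + n ℤ.+ + r
pos-*+ q n r = trans (ℤ.pos-+ (q * n) r) (cong (ℤ._+ + r) (ℤ.pos-* q n))

∣-+⁺ : ∀ {k i j l} → j ≡ i ℤ.+ l → k ∣ l → k ∣ i → k ∣ j
∣-+⁺ eq k∣l k∣i = subst (_ ∣_) (sym eq) (∣m∣n⇒∣m+n k∣i k∣l)

∣-+⁻ : ∀ {k i j l} → j ≡ i ℤ.+ l → k ∣ l → k ∣ j → k ∣ i
∣-+⁻ eq k∣l k∣j = ∣m+n∣n⇒∣m (subst (_ ∣_) eq k∣j) k∣l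

-- Taylor expansion in `y`. The linear coefficient `2y` is kept explicit for the lifting argument.
F-+ʸ : ∀ a b x y u m →
       F a b x (u ℤ.* m ℤ.+ y) ≡ F a b x y ℤ.+ (+ 2 ℤ.* y ℤ.* u ℤ.+ u ℤ.* u ℤ.* m) ℤ.* m
F-+ʸ = solve 6 (λ a b x y u m →
  :F a b x (u :* m :+ y) := :F a b x y :+ (con (+ 2) :* y :* u :+ u :* u :* m) :* m) refl

-- In the `x` direction only periodicity modulo `m` matters, so the cofactor is left existential.
F-+ˣ : ∀ a b x y u m → ∃ λ w → F a b (u ℤ.* m ℤ.+ x) y ≡ F a b x y ℤ.+ w ℤ.* m
F-+ˣ a b x y u m =
  ℤ.- (u ℤ.* (+ 3 ℤ.* x ℤ.* x ℤ.+ + 3 ℤ.* x ℤ.* (u ℤ.* m) ℤ.+ u ℤ.* m ℤ.* (u ℤ.* m) ℤ.+ a)) ,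
  solve 6 (λ a b x y u m → :F a b (u :* m :+ x) y := :F a b x y :+
    :- (u :* (con (+ 3) :* x :* x :+ con (+ 3) :* x :* (u :* m) :+ u :* m :* (u :* m) :+ a)) :* m) refl a b x y u m

n∣m*n : ∀ n m → n ∣ m ℤ.* n
n∣m*n n m = ∣n⇒∣m*n m ∣-refl

∣F-shiftʸ : ∀ a b m x q y →
  (+ m ∣ F a b (+ x) (+ (q * m + y)) → + m ∣ F a b (+ x) (+ y)) ×
  (+ m ∣ F a b (+ x) (+ y) → + m ∣ F a b (+ x) (+ (q * m + y)))
∣F-shiftʸ a b m x q y = ∣-+⁻ eq (n∣m*n (+ m) w) , ∣-+⁺ eq (n∣m*n (+ m) w)
  where
  w  = + 2 ℤ.* + y ℤ.* + q ℤ.+ + q ℤ.* + q ℤ.* + m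
  eq : F a b (+ x) (+ (q * m + y)) ≡ F a b (+ x) (+ y) ℤ.+ w ℤ.* + m
  eq = trans (cong (F a b (+ x)) (pos-*+ q m y)) (F-+ʸ a b (+ x) (+ y) (+ q) (+ m))

∣F-shiftˣ : ∀ a b m y q x →
  (+ m ∣ F a b (+ (q * m + x)) (+ y) → + m ∣ F a b (+ x) (+ y)) ×
  (+ m ∣ F a b (+ x) (+ y) → + m ∣ F a b (+ (q * m + x)) (+ y))
∣F-shiftˣ a b m y q x = ∣-+⁻ eq (n∣m*n (+ m) w) , ∣-+⁺ eq (n∣m*n (+ m) w)
  where
  w  = proj₁ (F-+ˣ a b (+ x) (+ y) (+ q) (+ m))
  eq : F a b (+ (q * m + x)) (+ y) ≡ F a b (+ x) (+ y) ℤ.+ w ℤ.* + m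
  eq = trans (cong (λ z → F a b z (+ y)) (pos-*+ q m x)) (proj₂ (F-+ˣ a b (+ x) (+ y) (+ q) (+ m)))

-- The device for summing a variable in or out: one solution when the guard holds, none when it
-- fails.
∑-guard : ∀ n {f : ℕ → ℕ} (P? : Dec P) → (P → ∑ n f ≡ 1) → (¬ P → ∀ i → f i ≡ 0) → ∑ n f ≡ ⟦ P? ⟧
∑-guard n (yes p) unique absent = unique p
∑-guard n (no ¬p) unique absent = ∑-zero n (λ i _ → absent ¬p i)

module _ (pr : Prime p) where

  private instance _ = prime⇒nonZero pr

  euclid : ∀ i j → + p ∣ i ℤ.* j → + p ∣ i ⊎ + p ∣ j
  euclid i j p∣ij with euclidsLemma ℤ.∣ i ∣ ℤ.∣ j ∣ pr (subst (p ℕ.∣_) (ℤ.abs-* i j) (∣⇒∣ᵤ p∣ij))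
  ... | inj₁ p∣i = inj₁ (∣ᵤ⇒∣ p∣i)
  ... | inj₂ p∣j = inj₂ (∣ᵤ⇒∣ p∣j)

  -- Bézout over the naturals has two shapes, according to which product is larger. They give the
  -- inverses `- y s` and `y s`, where `∣ d ∣ = s d`.
  inverse : ∀ d → ¬ + p ∣ d → ∃ λ e → + p ∣ d ℤ.* e ℤ.- + 1
  inverse d p∤d with m∣∣m∣ {d} | coprime-Bézout coprime
    where
    coprime : ∀ {i} → i ℕ.∣ p × i ℕ.∣ ℤ.∣ d ∣ → i ≡ 1
    coprime (i∣p , i∣d) with prime⇒irreducible pr i∣p
    ... | inj₁ i≡1  = i≡1
    ... | inj₂ refl = contradiction (∣ᵤ⇒∣ i∣d) p∤d
  ... | divides s ∣d∣≡sd | Bézout.+- x y eq = ℤ.- (+ y ℤ.* s) , divides (ℤ.- + x) (begin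
    d ℤ.* ℤ.- (+ y ℤ.* s) ℤ.- + 1     ≡⟨
      solve 3 (λ d y s → d :* :- (y :* s) :- con (+ 1) := :- (con (+ 1) :+ y :* (s :* d))) refl d (+ y) s ⟩
    ℤ.- (+ 1 ℤ.+ + y ℤ.* (s ℤ.* d))   ≡⟨ cong (λ z → ℤ.- (+ 1 ℤ.+ + y ℤ.* z)) ∣d∣≡sd ⟨
    ℤ.- (+ 1 ℤ.+ + y ℤ.* + ℤ.∣ d ∣)   ≡⟨ cong (λ z → ℤ.- (+ 1 ℤ.+ z)) (ℤ.pos-* y ℤ.∣ d ∣) ⟨
    ℤ.- + (1 + y * ℤ.∣ d ∣)           ≡⟨ cong (ℤ.-_ ∘ +_) eq ⟩
    ℤ.- + (x * p)                     ≡⟨ cong ℤ.-_ (ℤ.pos-* x p) ⟩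
    ℤ.- (+ x ℤ.* + p)                 ≡⟨ ℤ.neg-distribˡ-* (+ x) (+ p) ⟩
    ℤ.- + x ℤ.* + p                   ∎)
    where open ≡-Reasoning
  ... | divides s ∣d∣≡sd | Bézout.-+ x y eq = + y ℤ.* s , divides (+ x) (begin
    d ℤ.* (+ y ℤ.* s) ℤ.- + 1             ≡⟨
      solve 3 (λ d y s → d :* (y :* s) :- con (+ 1) := y :* (s :* d) :- con (+ 1)) refl d (+ y) s ⟩
    + y ℤ.* (s ℤ.* d) ℤ.- + 1             ≡⟨ cong (λ z → + y ℤ.* z ℤ.- + 1) ∣d∣≡sd ⟨
    + y ℤ.* + ℤ.∣ d ∣ ℤ.- + 1             ≡⟨ cong (ℤ._- + 1) (ℤ.pos-* y ℤ.∣ d ∣) ⟨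
    + (y * ℤ.∣ d ∣) ℤ.- + 1               ≡⟨ cong (λ z → + z ℤ.- + 1) eq ⟨
    + (1 + x * p) ℤ.- + 1                 ≡⟨ cong (λ z → + 1 ℤ.+ z ℤ.- + 1) (ℤ.pos-* x p) ⟩
    + 1 ℤ.+ + x ℤ.* + p ℤ.- + 1           ≡⟨ solve 1 (λ z → con (+ 1) :+ z :- con (+ 1) := z) refl (+ x ℤ.* + p) ⟩
    + x ℤ.* + p                           ∎)
    where open ≡-Reasoning

  residues-distinct : ∀ {i j} → i < p → j < p → + p ∣ + i ℤ.- + j → i ≡ j
  residues-distinct {i} {j} i<p j<p p∣i-j = ℤ.+-injective (ℤ.i-j≡0⇒i≡j (+ i) (+ j) (ℤ.∣i∣≡0⇒i≡0 ∣i-j∣≡0))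
    where
    ∣i-j∣<p : ℤ.∣ + i ℤ.- + j ∣ < p
    ∣i-j∣<p = subst (λ z → ℤ.∣ z ∣ < p) (sym (ℤ.m-n≡m⊖n i j))
                (ℕ.≤-<-trans (ℤ.∣m⊝n∣≤m⊔n i j) (ℕ.⊔-lub i<p j<p))
    ∣i-j∣≡0 : ℤ.∣ + i ℤ.- + j ∣ ≡ 0
    ∣i-j∣≡0 with ℤ.∣ + i ℤ.- + j ∣ | ∣i-j∣<p | ∣⇒∣ᵤ p∣i-j
    ... | zero  | _  | _   = refl
    ... | suc _ | <p | p∣ = contradiction (ℕ.∣⇒≤ p∣) (ℕ.<⇒≱ <p)

  -- The root is `- e c` reduced modulo `p`, with `e` inverse to `d`. The slope `t`, the coordinates
  -- `y` and `x` of the parametrised cusp, and the Hensel digit are all counted by this lemma.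
  linear-congruence : ∀ c d → ¬ + p ∣ d → ∑ p (λ u → ⟦ + p ∣? (c ℤ.+ d ℤ.* + u) ⟧) ≡ 1
  linear-congruence c d p∤d with e , p∣de-1 ← inverse d p∤d =
    ∑-unique p u₀ (n%ℕd<d z p) (⟦⟧-true (_ ∣? _) root) unique
    where
    z  = ℤ.- (e ℤ.* c)
    u₀ = z ℤ.%ℕ p
    k  = z ℤ./ℕ p
    root : + p ∣ c ℤ.+ d ℤ.* + u₀
    root = subst (+ p ∣_) (sym eq) (∣m∣n⇒∣m-n (∣n⇒∣m*n (ℤ.- c) p∣de-1) (n∣m*n (+ p) (d ℤ.* k)))
      where
      open ≡-Reasoning
      eq : c ℤ.+ d ℤ.* + u₀ ≡ ℤ.- c ℤ.* (d ℤ.* e ℤ.- + 1) ℤ.- d ℤ.* k ℤ.* + p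
      eq = begin
        c ℤ.+ d ℤ.* + u₀
          ≡⟨ solve 4 (λ c d u kp → c :+ d :* u := c :+ d :* (u :+ kp) :- d :* kp) refl c d (+ u₀) (k ℤ.* + p) ⟩
        c ℤ.+ d ℤ.* (+ u₀ ℤ.+ k ℤ.* + p) ℤ.- d ℤ.* (k ℤ.* + p)
          ≡⟨ cong (λ z → c ℤ.+ d ℤ.* z ℤ.- d ℤ.* (k ℤ.* + p)) (a≡a%ℕn+[a/ℕn]*n z p) ⟨
        c ℤ.+ d ℤ.* ℤ.- (e ℤ.* c) ℤ.- d ℤ.* (k ℤ.* + p)
          ≡⟨ solve 5 (λ c d e k q → c :+ d :* :- (e :* c) :- d :* (k :* q) :=
               :- c :* (d :* e :- con (+ 1)) :- d :* k :* q) refl c d e k (+ p) ⟩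
        ℤ.- c ℤ.* (d ℤ.* e ℤ.- + 1) ℤ.- d ℤ.* k ℤ.* + p ∎
    unique : ∀ i → i < p → i ≢ u₀ → ⟦ + p ∣? (c ℤ.+ d ℤ.* + i) ⟧ ≡ 0
    unique i i<p i≢u₀ = ⟦⟧-false (_ ∣? _) λ p∣ → i≢u₀ (residues-distinct i<p (n%ℕd<d z p)
      ([ (λ p∣d → contradiction p∣d p∤d) , id ]′ (euclid d (+ i ℤ.- + u₀)
        (subst (+ p ∣_) (solve 4 (λ c d i u → c :+ d :* i :- (c :+ d :* u) := d :* (i :- u)) refl c d (+ i) (+ u₀))
          (∣m∣n⇒∣m-n {m = c ℤ.+ d ℤ.* + i} p∣ root)))))

  p∣x²⇒p∣x : ∀ x → + p ∣ x ℤ.* x → + p ∣ x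
  p∣x²⇒p∣x x = [ id , id ]′ ∘ euclid x x

  -- y = t x turns y² ≡ x³ with x ≢ 0 into t² ≡ x.
  cusp-parametrisation : ∀ a b x y t → + p ∣ a → + p ∣ b → ¬ + p ∣ x →
    + p ∣ ℤ.- (t ℤ.* x) ℤ.+ + 1 ℤ.* y →
    (+ p ∣ F a b x y → + p ∣ t ℤ.* t ℤ.+ ℤ.- + 1 ℤ.* x) ×
    (+ p ∣ t ℤ.* t ℤ.+ ℤ.- + 1 ℤ.* x → + p ∣ F a b x y)
  cusp-parametrisation a b x y t p∣a p∣b p∤x p∣y-tx =
    (λ p∣F → [ (λ p∣xx → contradiction (p∣x²⇒p∣x x p∣xx) p∤x) , id ]′
               (euclid (x ℤ.* x) (t ℤ.* t ℤ.+ ℤ.- + 1 ℤ.* x) (∣-+⁻ eq p∣rest p∣F))) ,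
    (λ p∣ → ∣-+⁺ eq p∣rest (∣n⇒∣m*n (x ℤ.* x) p∣))
    where
    -- Obtained from `y² = (t x)² + (y - t x)(y + t x)`. The explicit coefficients `+ 1` and `- + 1`
    -- put both conditions into the shape `c + d * u` of `linear-congruence`.
    rest = (ℤ.- (t ℤ.* x) ℤ.+ + 1 ℤ.* y) ℤ.* (t ℤ.* x ℤ.+ y) ℤ.- (a ℤ.* x ℤ.+ b)
    p∣rest : + p ∣ rest
    p∣rest = ∣m∣n⇒∣m-n (∣m⇒∣m*n (t ℤ.* x ℤ.+ y) p∣y-tx) (∣m∣n⇒∣m+n (∣m⇒∣m*n x p∣a) p∣b)
    eq : F a b x y ≡ x ℤ.* x ℤ.* (t ℤ.* t ℤ.+ ℤ.- + 1 ℤ.* x) ℤ.+ rest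
    eq = solve 5 (λ a b x y t → :F a b x y :=
      x :* x :* (t :* t :+ :- con (+ 1) :* x) :+ ((:- (t :* x) :+ con (+ 1) :* y) :* (t :* x :+ y) :- (a :* x :+ b)))
      refl a b x y t

-- Points with p ∤ x

unit? : ∀ p x → Dec (¬ + p ∣ + x)
unit? p x = ¬? (+ p ∣? + x)

on? : ∀ m a b x y → Dec (+ m ∣ F a b (+ x) (+ y))
on? m a b x y = + m ∣? F a b (+ x) (+ y)

-- If `p` divides `a` and `b`, the reduction is `y² = x³`, whose singular point is the one with
-- `x = 0`. The modulus is a parameter of its own because lifting passes from `m` to `p * m`.
unitPoints singularPoints : (p m : ℕ) (a b : ℤ) → ℕ
unitPoints     p m a b = ∑ m (λ x → ∑ m (λ y → ⟦ unit? p x ×-dec on? m a b x y ⟧))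
singularPoints p m a b = ∑ m (λ x → ∑ m (λ y → ⟦ (+ p ∣? + x) ×-dec on? m a b x y ⟧))

∑-+ : ∀ n (f g : ℕ → ℕ) → ∑ n (λ i → f i + g i) ≡ ∑ n f + ∑ n g
∑-+ n f g = ∑-distrib-+ {n} (λ i → f (toℕ i)) (λ i → g (toℕ i))

N-split : ∀ p j a b → N p j a b ≡ unitPoints p (p ^ j) a b + singularPoints p (p ^ j) a b
N-split p j a b = begin
  N p j a b
    ≡⟨ N-∑ p j a b ⟩
  ∑ m (λ x → ∑ m (λ y → ⟦ on? m a b x y ⟧))
    ≡⟨ ∑-cong m (λ x _ → trans
         (∑-cong m (λ y _ → ⟦⟧-split (+ p ∣? + x) (on? m a b x y)))
         (∑-+ m (λ y → ⟦ unit? p x ×-dec on? m a b x y ⟧) (λ y → ⟦ (+ p ∣? + x) ×-dec on? m a b x y ⟧))) ⟩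
  ∑ m (λ x → ∑ m (λ y → ⟦ unit? p x ×-dec on? m a b x y ⟧) + ∑ m (λ y → ⟦ (+ p ∣? + x) ×-dec on? m a b x y ⟧))
    ≡⟨ ∑-+ m (λ x → ∑ m (λ y → ⟦ unit? p x ×-dec on? m a b x y ⟧))
             (λ x → ∑ m (λ y → ⟦ (+ p ∣? + x) ×-dec on? m a b x y ⟧)) ⟩
  unitPoints p m a b + singularPoints p m a b ∎
  where
  open ≡-Reasoning
  m = p ^ j

multiple-shift : ∀ {p m} q x → + p ∣ + m → (+ p ∣ + (q * m + x) → + p ∣ + x) × (+ p ∣ + x → + p ∣ + (q * m + x))
multiple-shift {p} {m} q x p∣m = ∣-+⁻ eq p∣qm , ∣-+⁺ eq p∣qm
  where
  p∣qm : + p ∣ + q ℤ.* + m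
  p∣qm = ∣n⇒∣m*n (+ q) p∣m
  eq : + (q * m + x) ≡ + x ℤ.+ + q ℤ.* + m
  eq = trans (pos-*+ q m x) (ℤ.+-comm (+ q ℤ.* + m) (+ x))

module _ (pr : Prime p) (2<p : 2 < p) {a b : ℤ} (p∣a : + p ∣ a) (p∣b : + p ∣ b) where

  private instance _ = prime⇒nonZero pr

  p∤1 : ¬ + p ∣ + 1
  p∤1 p∣1 = ℕ.<⇒≱ 2<p (ℕ.≤-trans (ℕ.∣⇒≤ (∣⇒∣ᵤ p∣1)) (s≤s z≤n))

  ∑-unit : ∑ p (λ t → ⟦ unit? p t ⟧) ≡ p ∸ 1
  ∑-unit = go p refl
    where
    go : ∀ n → n ≡ p → ∑ n (λ t → ⟦ unit? p t ⟧) ≡ n ∸ 1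
    go zero    _    = refl
    go (suc n) refl = cong₂ _+_
      (⟦⟧-false (unit? p 0) (λ p∤0 → p∤0 (divides (+ 0) refl)))
      (trans (∑-cong n (λ i i<n → ⟦⟧-true (unit? p (suc i)) (λ p∣ → ℕ.<⇒≱ (s≤s i<n) (ℕ.∣⇒≤ (∣⇒∣ᵤ p∣)))))
             (trans (∑-const n 1) (ℕ.*-identityʳ n)))

  -- Double counting: a sum over the slope `t = y / x` is inserted, with exactly one term per point,
  -- and moved outermost. For fixed `t`, first `y = t x` and then `x = t²` is determined, leaving
  -- one point for each unit `t`.
  unitPoints-p : unitPoints p p a b ≡ p ∸ 1
  unitPoints-p = begin
    ∑ p (λ x → ∑ p (λ y → ⟦ unit? p x ×-dec on? p a b x y ⟧))
      ≡⟨ ∑-cong p (λ x _ → ∑-cong p (λ y _ → introduce-slope x y)) ⟩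
    ∑ p (λ x → ∑ p (λ y → ∑ p (λ t → ⟦ param? t x ×-dec slope? t x y ⟧)))
      ≡⟨ ∑-cong p (λ x _ → ∑-swap p p (λ y t → ⟦ param? t x ×-dec slope? t x y ⟧)) ⟩
    ∑ p (λ x → ∑ p (λ t → ∑ p (λ y → ⟦ param? t x ×-dec slope? t x y ⟧)))
      ≡⟨ ∑-swap p p (λ x t → ∑ p (λ y → ⟦ param? t x ×-dec slope? t x y ⟧)) ⟩
    ∑ p (λ t → ∑ p (λ x → ∑ p (λ y → ⟦ param? t x ×-dec slope? t x y ⟧)))
      ≡⟨ ∑-cong p (λ t _ → ∑-cong p (λ x _ → eliminate-y t x)) ⟩
    ∑ p (λ t → ∑ p (λ x → ⟦ param? t x ⟧))
      ≡⟨ ∑-cong p (λ t _ → eliminate-x t) ⟩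
    ∑ p (λ t → ⟦ unit? p t ⟧)
      ≡⟨ ∑-unit ⟩
    p ∸ 1 ∎
    where
    open ≡-Reasoning

    square? : ∀ t x → Dec (+ p ∣ + t ℤ.* + t ℤ.+ ℤ.- + 1 ℤ.* + x)
    square? t x = _ ∣? _

    param? : ∀ t x → Dec (¬ + p ∣ + x × + p ∣ + t ℤ.* + t ℤ.+ ℤ.- + 1 ℤ.* + x)
    param? t x = unit? p x ×-dec square? t x

    slope? : ∀ t x y → Dec (+ p ∣ ℤ.- (+ t ℤ.* + x) ℤ.+ + 1 ℤ.* + y)
    slope? t x y = _ ∣? _

    introduce-slope : ∀ x y → ⟦ unit? p x ×-dec on? p a b x y ⟧ ≡ ∑ p (λ t → ⟦ param? t x ×-dec slope? t x y ⟧)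
    introduce-slope x y = sym (∑-guard p (unit? p x ×-dec on? p a b x y)
      (λ (p∤x , on) → trans
        (∑-cong p (λ t _ → ⟦⟧-cong
          (λ (_ , p∣) → subst (+ p ∣_) (slope-sym t) p∣)
          (λ p∣ → let p∣slope = subst (+ p ∣_) (sym (slope-sym t)) p∣ in
            (p∤x , proj₁ (cusp-parametrisation pr a b _ _ (+ t) p∣a p∣b p∤x p∣slope) on) , p∣slope)
          (param? t x ×-dec slope? t x y) (_ ∣? _)))
        -- Here the unknown is `t`, and its coefficient `- x` is a unit.
        (linear-congruence pr (+ y) (ℤ.- + x) (λ p∣-x → p∤x (subst (+ p ∣_) (ℤ.neg-involutive (+ x)) (∣m⇒∣-m p∣-x)))))
      (λ off t → ⟦⟧-false (param? t x ×-dec slope? t x y) λ ((p∤x , p∣) , p∣slope) →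
        off (p∤x , proj₂ (cusp-parametrisation pr a b _ _ (+ t) p∣a p∣b p∤x p∣slope) p∣)))
      where
      slope-sym : ∀ t → ℤ.- (+ t ℤ.* + x) ℤ.+ + 1 ℤ.* + y ≡ + y ℤ.+ ℤ.- + x ℤ.* + t
      slope-sym t = solve 3 (λ t x y → :- (t :* x) :+ con (+ 1) :* y := y :+ :- x :* t) refl (+ t) (+ x) (+ y)

    eliminate-y : ∀ t x → ∑ p (λ y → ⟦ param? t x ×-dec slope? t x y ⟧) ≡ ⟦ param? t x ⟧
    eliminate-y t x = ∑-guard p (param? t x)
      (λ par → trans
        (∑-cong p (λ y _ → ⟦⟧-cong proj₂ (par ,_) (param? t x ×-dec slope? t x y) (slope? t x y)))
        (linear-congruence pr (ℤ.- (+ t ℤ.* + x)) (+ 1) p∤1))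
      (λ ¬par y → ⟦⟧-false (param? t x ×-dec slope? t x y) (¬par ∘ proj₁))

    eliminate-x : ∀ t → ∑ p (λ x → ⟦ param? t x ⟧) ≡ ⟦ unit? p t ⟧
    eliminate-x t = ∑-guard p (unit? p t)
      (λ p∤t → trans
        (∑-cong p (λ x _ → ⟦⟧-cong proj₂
          (λ p∣ → (λ p∣x → p∤t (p∣x²⇒p∣x pr (+ t) (∣m+n∣n⇒∣m p∣ (∣n⇒∣m*n (ℤ.- + 1) p∣x)))) , p∣)
          (param? t x) (square? t x)))
        (linear-congruence pr (+ t ℤ.* + t) (ℤ.- + 1) (p∤1 ∘ ∣m⇒∣-m)))
      (λ ¬p∤t x → ⟦⟧-false (param? t x) λ (p∤x , p∣) → ¬p∤t λ p∣t → p∤x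
        (subst (+ p ∣_) (solve 1 (λ x → :- (:- con (+ 1) :* x) := x) refl (+ x))
          (∣m⇒∣-m (∣m+n∣m⇒∣n {m = + t ℤ.* + t} p∣ (∣m⇒∣m*n (+ t) p∣t)))))

  p∤2 : ¬ + p ∣ + 2
  p∤2 p∣2 = ℕ.<⇒≱ 2<p (ℕ.∣⇒≤ (∣⇒∣ᵤ p∣2))

  -- Modulo `p` the equation is `y² ≡ x³`. Together with `p∤2` this makes `2y` a unit.
  p∤x⇒p∤y : ∀ x y → + p ∣ F a b x y → ¬ + p ∣ x → ¬ + p ∣ y
  p∤x⇒p∤y x y p∣F p∤x p∣y = [ p∤x , p∤x ∘ p∣x²⇒p∣x pr x ]′ (euclid pr x (x ℤ.* x)
    (subst (+ p ∣_) (solve 4 (λ a b x y → y :* y :- (:F a b x y :+ (a :* x :+ b)) := x :* (x :* x)) refl a b x y)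
      (∣m∣n⇒∣m-n {m = y ℤ.* y} (∣n⇒∣m*n y p∣y) (∣m∣n⇒∣m+n {m = F a b x y} p∣F (∣m∣n⇒∣m+n (∣m⇒∣m*n x p∣a) p∣b)))))

  -- Hensel: the y-derivative 2y is a unit, so every point with p ∤ x has exactly p lifts,
  -- one for each lift of its x-coordinate.
  unitPoints-lift : ∀ m .{{_ : NonZero m}} → + p ∣ + m → unitPoints p (p * m) a b ≡ p * unitPoints p m a b
  unitPoints-lift m p∣m = begin
    ∑ (p * m) (λ x → ∑ (p * m) (λ y → lifted x y))
      -- Only `y` is split, into a residue modulo `m` and a new digit `u`: for each `x` modulo
      -- `p * m` that digit is unique.
      ≡⟨ ∑-cong (p * m) (λ x _ → ∑-block p m (lifted x)) ⟩
    ∑ (p * m) (λ x → ∑ p (λ u → ∑ m (λ y → lifted x (u * m + y))))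
      ≡⟨ ∑-cong (p * m) (λ x _ → ∑-swap p m (λ u y → lifted x (u * m + y))) ⟩
    ∑ (p * m) (λ x → ∑ m (λ y → ∑ p (λ u → lifted x (u * m + y))))
      ≡⟨ ∑-cong (p * m) (λ x _ → ∑-cong m (λ y _ → unique-lift x y)) ⟩
    ∑ (p * m) (λ x → ∑ m (λ y → ⟦ unit? p x ×-dec on? m a b x y ⟧))
      ≡⟨ ∑-periodic p m (λ x → ∑ m (λ y → ⟦ unit? p x ×-dec on? m a b x y ⟧)) (λ q x → ∑-cong m (λ y _ → periodic q x y)) ⟩
    p * unitPoints p m a b ∎
    where
    open ≡-Reasoning

    lifted : ℕ → ℕ → ℕ
    lifted x y = ⟦ unit? p x ×-dec on? (p * m) a b x y ⟧

    periodic : ∀ q x y → ⟦ unit? p (q * m + x) ×-dec on? m a b (q * m + x) y ⟧ ≡ ⟦ unit? p x ×-dec on? m a b x y ⟧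
    periodic q x y = ⟦⟧-cong
      (λ (p∤ , on) → p∤ ∘ proj₂ (multiple-shift q x p∣m) , proj₁ (∣F-shiftˣ a b m y q x) on)
      (λ (p∤ , on) → p∤ ∘ proj₁ (multiple-shift q x p∣m) , proj₂ (∣F-shiftˣ a b m y q x) on)
      (unit? p (q * m + x) ×-dec on? m a b (q * m + x) y) (unit? p x ×-dec on? m a b x y)

    unique-lift : ∀ x y → ∑ p (λ u → lifted x (u * m + y)) ≡ ⟦ unit? p x ×-dec on? m a b x y ⟧
    unique-lift x y = ∑-guard p (unit? p x ×-dec on? m a b x y) lift no-lift
      where
      no-lift : ¬ (¬ + p ∣ + x × + m ∣ F a b (+ x) (+ y)) → ∀ u → lifted x (u * m + y) ≡ 0
      no-lift off u = ⟦⟧-false (unit? p x ×-dec on? (p * m) a b x (u * m + y)) λ (p∤x , on) →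
        off (p∤x , proj₁ (∣F-shiftʸ a b m x u y) (∣-trans (subst (+ m ∣_) (sym (ℤ.pos-* p m)) (n∣m*n (+ m) (+ p))) on))

      lift : ¬ + p ∣ + x × + m ∣ F a b (+ x) (+ y) → ∑ p (λ u → lifted x (u * m + y)) ≡ 1
      lift (p∤x , m∣F@(divides c F≡cm)) = trans
        (∑-cong p (λ u _ → ⟦⟧-cong
          (λ (_ , on) → *-cancelʳ-∣ (+ m) (subst (_∣ _) (ℤ.pos-* p m) (∣-+⁻ (expand u) (pm∣rest u) on)))
          (λ p∣ → p∤x , ∣-+⁺ (expand u) (pm∣rest u) (subst (_∣ _) (sym (ℤ.pos-* p m)) (*-monoˡ-∣ (+ m) p∣)))
          (unit? p x ×-dec on? (p * m) a b x (u * m + y)) (+ p ∣? (c ℤ.+ (+ 2 ℤ.* + y) ℤ.* + u))))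
        (linear-congruence pr c (+ 2 ℤ.* + y)
          ([ p∤2 , p∤x⇒p∤y (+ x) (+ y) (∣-trans p∣m m∣F) p∤x ]′ ∘ euclid pr (+ 2) (+ y)))
        where
        -- The quadratic term `u² m²` vanishes modulo `p * m` because `p ∣ m`. Cancelling `m` from
        -- what remains leaves a congruence modulo `p` that is linear in `u`.
        rest : ℕ → ℤ
        rest u = (+ u ℤ.* + u ℤ.* + m) ℤ.* + m
        pm∣rest : ∀ u → + (p * m) ∣ rest u
        pm∣rest u = subst (_∣ rest u) (sym (ℤ.pos-* p m)) (*-monoˡ-∣ (+ m) (∣n⇒∣m*n (+ u ℤ.* + u) p∣m))
        expand : ∀ u → F a b (+ x) (+ (u * m + y)) ≡ (c ℤ.+ (+ 2 ℤ.* + y) ℤ.* + u) ℤ.* + m ℤ.+ rest u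
        expand u = begin
          F a b (+ x) (+ (u * m + y))
            ≡⟨ cong (F a b (+ x)) (pos-*+ u m y) ⟩
          F a b (+ x) (+ u ℤ.* + m ℤ.+ + y)
            ≡⟨ F-+ʸ a b (+ x) (+ y) (+ u) (+ m) ⟩
          F a b (+ x) (+ y) ℤ.+ (+ 2 ℤ.* + y ℤ.* + u ℤ.+ + u ℤ.* + u ℤ.* + m) ℤ.* + m
            ≡⟨ cong (ℤ._+ (+ 2 ℤ.* + y ℤ.* + u ℤ.+ + u ℤ.* + u ℤ.* + m) ℤ.* + m) F≡cm ⟩
          c ℤ.* + m ℤ.+ (+ 2 ℤ.* + y ℤ.* + u ℤ.+ + u ℤ.* + u ℤ.* + m) ℤ.* + m
            ≡⟨ solve 4 (λ c y u m → c :* m :+ (con (+ 2) :* y :* u :+ u :* u :* m) :* m :=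
                 (c :+ con (+ 2) :* y :* u) :* m :+ u :* u :* m :* m) refl c (+ y) (+ u) (+ m) ⟩
          (c ℤ.+ (+ 2 ℤ.* + y) ℤ.* + u) ℤ.* + m ℤ.+ rest u ∎

  unitPoints-^ : ∀ j → unitPoints p (p ^ suc j) a b ≡ (p ∸ 1) * p ^ j
  unitPoints-^ zero    = trans (cong (λ m → unitPoints p m a b) (ℕ.^-identityʳ p))
                               (trans unitPoints-p (sym (ℕ.*-identityʳ (p ∸ 1))))
  unitPoints-^ (suc j) = begin
    unitPoints p (p * p ^ suc j) a b    ≡⟨ unitPoints-lift (p ^ suc j) {{ℕ.m^n≢0 p (suc j)}} (∣ᵤ⇒∣ (ℕ.m∣m*n (p ^ j))) ⟩
    p * unitPoints p (p ^ suc j) a b    ≡⟨ cong (p *_) (unitPoints-^ j) ⟩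
    p * ((p ∸ 1) * p ^ j)               ≡⟨ ℕ.*-assoc p (p ∸ 1) (p ^ j) ⟨
    p * (p ∸ 1) * p ^ j                 ≡⟨ cong (_* p ^ j) (ℕ.*-comm p (p ∸ 1)) ⟩
    (p ∸ 1) * p * p ^ j                 ≡⟨ ℕ.*-assoc (p ∸ 1) p (p ^ j) ⟩
    (p ∸ 1) * p ^ suc j                 ∎
    where open ≡-Reasoning

-- Points with p ∣ x

pos-^ : ∀ m n → + (m ^ n) ≡ (+ m) ℤ.^ n
pos-^ m zero    = refl
pos-^ m (suc n) = trans (ℤ.pos-* m (m ^ n)) (cong (+ m ℤ.*_) (pos-^ m n))

^-distribʳ-* : ∀ m n o → (m * n) ^ o ≡ m ^ o * n ^ o
^-distribʳ-* m n zero    = refl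
^-distribʳ-* m n (suc o) = trans (cong (m * n *_) (^-distribʳ-* m n o)) (ℕ.[m*n]*[o*p]≡[m*o]*[n*p] m n (m ^ o) (n ^ o))

^-∣ℕ : ∀ p {d e} → d ≤ e → p ^ d ℕ.∣ p ^ e
^-∣ℕ p d≤e = ∣⇒∣ᵤ (^-∣ p d≤e)

p^i∣z⇒p^in∣z^n : ∀ p i n {z} → p ^ i ℕ.∣ z → p ^ (i * n) ℕ.∣ z ^ n
p^i∣z⇒p^in∣z^n p i n (ℕ.divides w refl) = ℕ.divides (w ^ n)
  (trans (^-distribʳ-* w (p ^ i) n) (cong (w ^ n *_) (ℕ.^-*-assoc p i n)))

prime∣^ : Prime p → ∀ n {w} → p ℕ.∣ w ^ n → p ℕ.∣ w
prime∣^ pr zero    {w} p∣1 = ℕ.∣-trans p∣1 (ℕ.1∣ w)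
prime∣^ pr (suc n) {w} p∣ = [ id , prime∣^ pr n ]′ (euclidsLemma w (w ^ n) pr p∣)

-- Valuations are integers: `n v(z) ≥ i n + 1` rounds up to `v(z) ≥ i + 1`. Concretely, cancelling
-- `p ^ (i * n)` leaves `p ∣ w ^ n` for the cofactor `w`.
root-∣ : Prime p → ∀ n i {z} → p ^ i ℕ.∣ z → p ^ suc (i * n) ℕ.∣ z ^ n → p ^ suc i ℕ.∣ z
root-∣ {p} pr n i (ℕ.divides w refl) p∣z^n =
  ℕ.*-monoˡ-∣ (p ^ i) (prime∣^ pr n (ℕ.*-cancelʳ-∣ (p ^ (i * n)) {{ℕ.m^n≢0 p (i * n)}}
  (subst (p ^ suc (i * n) ℕ.∣_) (trans (^-distribʳ-* w (p ^ i) n) (cong (w ^ n *_) (ℕ.^-*-assoc p i n))) p∣z^n)))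
  where instance _ = prime⇒nonZero pr

∣F∧∣x³⇒∣y² : ∀ {m} a b x y → + m ∣ a ℤ.* + x ℤ.+ b → + m ∣ F a b (+ x) (+ y) → m ℕ.∣ x ^ 3 → m ℕ.∣ y ^ 2
∣F∧∣x³⇒∣y² {m} a b x y m∣ax+b m∣F m∣x³ = ∣⇒∣ᵤ (subst (+ m ∣_) eq
  (∣m∣n⇒∣m+n {m = F a b (+ x) (+ y)} m∣F (∣m∣n⇒∣m+n (subst (+ m ∣_) (pos-^ x 3) (∣ᵤ⇒∣ m∣x³)) m∣ax+b)))
  where
  eq : F a b (+ x) (+ y) ℤ.+ ((+ x) ℤ.^ 3 ℤ.+ (a ℤ.* + x ℤ.+ b)) ≡ + (y ^ 2)
  eq = trans (solve 4 (λ a b x y → :F a b x y :+ (x :^ 3 :+ (a :* x :+ b)) := y :^ 2) refl a b (+ x) (+ y)) (sym (pos-^ y 2))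

∣F∧∣y²⇒∣x³ : ∀ {m} a b x y → + m ∣ a ℤ.* + x ℤ.+ b → + m ∣ F a b (+ x) (+ y) → m ℕ.∣ y ^ 2 → m ℕ.∣ x ^ 3
∣F∧∣y²⇒∣x³ {m} a b x y m∣ax+b m∣F m∣y² = ∣⇒∣ᵤ (subst (+ m ∣_) eq
  (∣m∣n⇒∣m-n (subst (+ m ∣_) (pos-^ y 2) (∣ᵤ⇒∣ m∣y²)) (∣m∣n⇒∣m+n {m = F a b (+ x) (+ y)} m∣F m∣ax+b)))
  where
  eq : (+ y) ℤ.^ 2 ℤ.- (F a b (+ x) (+ y) ℤ.+ (a ℤ.* + x ℤ.+ b)) ≡ + (x ^ 3)
  eq = trans (solve 4 (λ a b x y → y :^ 2 :- (:F a b x y :+ (a :* x :+ b)) := x :^ 3) refl a b (+ x) (+ y)) (sym (pos-^ x 3))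

∣x³∧∣y²⇒∣F : ∀ {m} a b x y → + m ∣ a ℤ.* + x ℤ.+ b → m ℕ.∣ x ^ 3 → m ℕ.∣ y ^ 2 → + m ∣ F a b (+ x) (+ y)
∣x³∧∣y²⇒∣F {m} a b x y m∣ax+b m∣x³ m∣y² = subst (+ m ∣_) eq
  (∣m∣n⇒∣m-n {m = + (y ^ 2)} (∣ᵤ⇒∣ m∣y²) (∣m∣n⇒∣m+n {m = + (x ^ 3)} (∣ᵤ⇒∣ m∣x³) m∣ax+b))
  where
  eq : + (y ^ 2) ℤ.- (+ (x ^ 3) ℤ.+ (a ℤ.* + x ℤ.+ b)) ≡ F a b (+ x) (+ y)
  eq = trans (cong₂ (λ u v → u ℤ.- (v ℤ.+ (a ℤ.* + x ℤ.+ b))) (pos-^ y 2) (pos-^ x 3))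
             (solve 4 (λ a b x y → y :^ 2 :- (x :^ 3 :+ (a :* x :+ b)) := :F a b x y) refl a b (+ x) (+ y))

≤! : ∀ m {n} {_ : True (m ℕ.≤? n)} → m ≤ n
≤! m {_} {m≤n} = toWitness m≤n

∣⇒^1∣ : ∀ {m} → p ℕ.∣ m → p ^ 1 ℕ.∣ m
∣⇒^1∣ {p} = subst (ℕ._∣ _) (sym (ℕ.^-identityʳ p))

module _ (pr : Prime p) {a b : ℤ} (p⁴∣a : + (p ^ 4) ∣ a) (p⁶∣b : + (p ^ 6) ∣ b) where

  private instance _ = prime⇒nonZero pr

  -- The exponent is 4 from `a` plus 1 from `x`. Up to this precision the curve is just `y² ≡ x³`,
  -- and the last divisibility derived below, `p³∣y`, needs no more.
  p⁵∣ax+b : ∀ x → p ℕ.∣ x → + (p ^ 5) ∣ a ℤ.* + x ℤ.+ b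
  p⁵∣ax+b x p∣x = ∣m∣n⇒∣m+n {m = a ℤ.* + x}
    (∣ᵤ⇒∣ (subst (p ^ 5 ℕ.∣_) (trans (ℕ.*-comm x ℤ.∣ a ∣) (sym (ℤ.abs-* a (+ x)))) (ℕ.*-pres-∣ p∣x (∣⇒∣ᵤ p⁴∣a))))
    (∣-trans (^-∣ p (ℕ.n≤1+n 5)) p⁶∣b)

  module _ {j} x y (p∣x : p ℕ.∣ x) (p^j∣F : + (p ^ j) ∣ F a b (+ x) (+ y)) where

    private
      x³⇒y² : ∀ {e} → e ≤ j → e ≤ 5 → p ^ e ℕ.∣ x ^ 3 → p ^ e ℕ.∣ y ^ 2
      x³⇒y² e≤j e≤5 = ∣F∧∣x³⇒∣y² a b x y (∣-trans (^-∣ p e≤5) (p⁵∣ax+b x p∣x)) (∣-trans (^-∣ p e≤j) p^j∣F)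

      y²⇒x³ : ∀ {e} → e ≤ j → e ≤ 5 → p ^ e ℕ.∣ y ^ 2 → p ^ e ℕ.∣ x ^ 3
      y²⇒x³ e≤j e≤5 = ∣F∧∣y²⇒∣x³ a b x y (∣-trans (^-∣ p e≤5) (p⁵∣ax+b x p∣x)) (∣-trans (^-∣ p e≤j) p^j∣F)

      p³∣x³ : p ^ 3 ℕ.∣ x ^ 3
      p³∣x³ = p^i∣z⇒p^in∣z^n p 1 3 (∣⇒^1∣ p∣x)

    -- The thresholds 1, 3, 4, 5 on `j` in this and the next three lemmas are the exponents
    -- `suc (i * n)` at which `root-∣` gains one more factor, with `n = 2` for `y` and `n = 3` for
    -- `x`.
    p∣y : 1 ≤ j → p ^ 1 ℕ.∣ y
    p∣y 1≤j = root-∣ pr 2 0 (ℕ.1∣ y) (x³⇒y² {1} 1≤j (s≤s z≤n) (ℕ.∣-trans (^-∣ℕ p {1} {3} (s≤s z≤n)) p³∣x³))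

    p²∣y : 3 ≤ j → p ^ 2 ℕ.∣ y
    p²∣y 3≤j = root-∣ pr 2 1 (p∣y (ℕ.≤-trans (s≤s z≤n) 3≤j)) (x³⇒y² {3} 3≤j (ℕ.m≤m+n 3 2) p³∣x³)

    p²∣x : 4 ≤ j → p ^ 2 ℕ.∣ x
    p²∣x 4≤j = root-∣ pr 3 1 (∣⇒^1∣ p∣x)
      (y²⇒x³ {4} 4≤j (ℕ.m≤m+n 4 1) (p^i∣z⇒p^in∣z^n p 2 2 (p²∣y (ℕ.≤-trans (ℕ.n≤1+n 3) 4≤j))))

    p³∣y : 5 ≤ j → p ^ 3 ℕ.∣ y
    p³∣y 5≤j = root-∣ pr 2 2 (p²∣y (ℕ.≤-trans (ℕ.m≤m+n 3 2) 5≤j))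
      (x³⇒y² {5} 5≤j ℕ.≤-refl (ℕ.∣-trans (^-∣ℕ p {5} {6} (ℕ.n≤1+n 5)) (p^i∣z⇒p^in∣z^n p 2 3 (p²∣x (ℕ.≤-trans (ℕ.n≤1+n 4) 5≤j)))))

  -- Shared by the base values and the scaling step, which differ only in how the condition on the
  -- new variables is evaluated.
  singularPoints-multiples : ∀ j m n α β → j ≡ m + α → j ≡ n + β →
    (∀ x y → p ℕ.∣ x → + (p ^ j) ∣ F a b (+ x) (+ y) → p ^ α ℕ.∣ x × p ^ β ℕ.∣ y) →
    singularPoints p (p ^ j) a b ≡
    ∑ (p ^ m) (λ x → ∑ (p ^ n) (λ y → ⟦ (+ p ∣? + (x * p ^ α)) ×-dec on? (p ^ j) a b (x * p ^ α) (y * p ^ β) ⟧))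
  singularPoints-multiples j m n α β j≡m+α j≡n+β div =
    ∑∑-multiples (p ^ m) (p ^ n) (p ^ α) (p ^ β) {{ℕ.m^n≢0 p α}} {{ℕ.m^n≢0 p β}} _
      (trans (cong (p ^_) j≡m+α) (ℕ.^-distribˡ-+-* p m α))
      (trans (cong (p ^_) j≡n+β) (ℕ.^-distribˡ-+-* p n β))
      (λ x y ¬div → ⟦⟧-false ((+ p ∣? + x) ×-dec on? (p ^ j) a b x y) λ (p∣x , on) → ¬div (div x y (∣⇒∣ᵤ p∣x) on))

  -- Once `x` and `y` carry the factors `p ^ α` and `p ^ β`, all of `x³`, `y²` and `a x + b` vanish
  -- modulo `p ^ j`, so every remaining pair is counted.
  singularPoints-base : ∀ j m n α β → j ≡ m + α → j ≡ n + β →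
    (∀ x y → p ℕ.∣ x → + (p ^ j) ∣ F a b (+ x) (+ y) → p ^ α ℕ.∣ x × p ^ β ℕ.∣ y) →
    1 ≤ α → j ≤ α * 3 → j ≤ β * 2 → j ≤ 5 → singularPoints p (p ^ j) a b ≡ p ^ (m + n)
  singularPoints-base j m n α β j≡m+α j≡n+β div 1≤α j≤3α j≤2β j≤5 = begin
    singularPoints p (p ^ j) a b
      ≡⟨ singularPoints-multiples j m n α β j≡m+α j≡n+β div ⟩
    ∑ (p ^ m) (λ x → ∑ (p ^ n) (λ y → ⟦ (+ p ∣? + (x * p ^ α)) ×-dec on? (p ^ j) a b (x * p ^ α) (y * p ^ β) ⟧))
      ≡⟨ ∑-cong (p ^ m) (λ x _ → ∑-cong (p ^ n) (λ y _ →
           ⟦⟧-true ((+ p ∣? + (x * p ^ α)) ×-dec on? (p ^ j) a b (x * p ^ α) (y * p ^ β)) (∣ᵤ⇒∣ (p∣xp^α x) , on x y))) ⟩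
    ∑ (p ^ m) (λ _ → ∑ (p ^ n) (λ _ → 1))
      ≡⟨ ∑-const (p ^ m) _ ⟩
    p ^ m * ∑ (p ^ n) (λ _ → 1)
      ≡⟨ cong (p ^ m *_) (trans (∑-const (p ^ n) 1) (ℕ.*-identityʳ (p ^ n))) ⟩
    p ^ m * p ^ n
      ≡⟨ ℕ.^-distribˡ-+-* p m n ⟨
    p ^ (m + n) ∎
    where
    open ≡-Reasoning
    p∣xp^α : ∀ x → p ℕ.∣ x * p ^ α
    p∣xp^α x = ℕ.∣n⇒∣m*n x (subst (ℕ._∣ p ^ α) (ℕ.^-identityʳ p) (^-∣ℕ p 1≤α))
    on : ∀ x y → + (p ^ j) ∣ F a b (+ (x * p ^ α)) (+ (y * p ^ β))
    on x y = ∣x³∧∣y²⇒∣F a b (x * p ^ α) (y * p ^ β) (∣-trans (^-∣ p j≤5) (p⁵∣ax+b _ (p∣xp^α x)))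
      (ℕ.∣-trans (^-∣ℕ p j≤3α) (p^i∣z⇒p^in∣z^n p α 3 (ℕ.n∣m*n x)))
      (ℕ.∣-trans (^-∣ℕ p j≤2β) (p^i∣z⇒p^in∣z^n p β 2 (ℕ.n∣m*n y)))

  -- The cases take `α = ⌈j/3⌉` and `β = ⌈j/2⌉`, giving `p ^ (2j - α - β)`. Since `α + β` equals `j`
  -- for `2 ≤ j ≤ 5` but 2 for `j = 1`, the value `M p 1` is exceptional.
  singularPoints-M : ∀ j → 1 ≤ j → j < 6 → singularPoints p (p ^ j) a b ≡ M p j
  singularPoints-M 1 _ _ = singularPoints-base 1 0 0 1 1 refl refl
    (λ x y p∣x on → ∣⇒^1∣ p∣x , p∣y {j = 1} x y p∣x on (≤! 1)) (≤! 1) (≤! 1) (≤! 1) (≤! 1)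
  singularPoints-M 2 _ _ = singularPoints-base 2 1 1 1 1 refl refl
    (λ x y p∣x on → ∣⇒^1∣ p∣x , p∣y {j = 2} x y p∣x on (≤! 1)) (≤! 1) (≤! 2) (≤! 2) (≤! 2)
  singularPoints-M 3 _ _ = singularPoints-base 3 2 1 1 2 refl refl
    (λ x y p∣x on → ∣⇒^1∣ p∣x , p²∣y {j = 3} x y p∣x on (≤! 3)) (≤! 1) (≤! 3) (≤! 3) (≤! 3)
  singularPoints-M 4 _ _ = singularPoints-base 4 2 2 2 2 refl refl
    (λ x y p∣x on → p²∣x {j = 4} x y p∣x on (≤! 4) , p²∣y {j = 4} x y p∣x on (≤! 3)) (≤! 1) (≤! 4) (≤! 4) (≤! 4)
  singularPoints-M 5 _ _ = singularPoints-base 5 3 2 2 3 refl refl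
    (λ x y p∣x on → p²∣x {j = 5} x y p∣x on (≤! 4) , p³∣y {j = 5} x y p∣x on (≤! 5)) (≤! 1) (≤! 5) (≤! 5) (≤! 5)
  singularPoints-M (suc (suc (suc (suc (suc (suc _)))))) _ (s≤s (s≤s (s≤s (s≤s (s≤s (s≤s ()))))))

-- The scaling step

-- With weights 2, 3, 4, 6 for `x`, `y`, `a`, `b`, the polynomial is homogeneous of weight 6.
F-scale : ∀ p a b x y →
  F (a ℤ.* + (p ^ 4)) (b ℤ.* + (p ^ 6)) (+ (x * p ^ 2)) (+ (y * p ^ 3)) ≡ F a b (+ x) (+ y) ℤ.* + (p ^ 6)
F-scale p a b x y = begin
  F (a ℤ.* + (p ^ 4)) (b ℤ.* + (p ^ 6)) (+ (x * p ^ 2)) (+ (y * p ^ 3))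
    ≡⟨ cong₂ (F (a ℤ.* + (p ^ 4)) (b ℤ.* + (p ^ 6))) (cast x 2) (cast y 3) ⟩
  F (a ℤ.* + (p ^ 4)) (b ℤ.* + (p ^ 6)) (+ x ℤ.* (+ p) ℤ.^ 2) (+ y ℤ.* (+ p) ℤ.^ 3)
    ≡⟨ cong₂ (λ u v → F (a ℤ.* u) (b ℤ.* v) (+ x ℤ.* (+ p) ℤ.^ 2) (+ y ℤ.* (+ p) ℤ.^ 3)) (pos-^ p 4) (pos-^ p 6) ⟩
  F (a ℤ.* (+ p) ℤ.^ 4) (b ℤ.* (+ p) ℤ.^ 6) (+ x ℤ.* (+ p) ℤ.^ 2) (+ y ℤ.* (+ p) ℤ.^ 3)
    ≡⟨ solve 5 (λ a b x y q → :F (a :* q :^ 4) (b :* q :^ 6) (x :* q :^ 2) (y :* q :^ 3) := :F a b x y :* q :^ 6)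
         refl a b (+ x) (+ y) (+ p) ⟩
  F a b (+ x) (+ y) ℤ.* (+ p) ℤ.^ 6
    ≡⟨ cong (F a b (+ x) (+ y) ℤ.*_) (pos-^ p 6) ⟨
  F a b (+ x) (+ y) ℤ.* + (p ^ 6) ∎
  where
  open ≡-Reasoning
  cast : ∀ x n → + (x * p ^ n) ≡ + x ℤ.* (+ p) ℤ.^ n
  cast x n = trans (ℤ.pos-* x (p ^ n)) (cong (+ x ℤ.*_) (pos-^ p n))

∑∑-periodic : ∀ s t m (f : ℕ → ℕ → ℕ) → (∀ q x y → f (q * m + x) y ≡ f x y) → (∀ q x y → f x (q * m + y) ≡ f x y) →
              ∑ (s * m) (λ x → ∑ (t * m) (f x)) ≡ s * (t * ∑ m (λ x → ∑ m (f x)))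
∑∑-periodic s t m f perˣ perʸ = begin
  ∑ (s * m) (λ x → ∑ (t * m) (f x)) ≡⟨ ∑-cong (s * m) (λ x _ → ∑-periodic t m (f x) (λ q y → perʸ q x y)) ⟩
  ∑ (s * m) (λ x → t * ∑ m (f x))   ≡⟨ ∑-periodic s m _ (λ q x → cong (t *_) (∑-cong m (λ y _ → perˣ q x y))) ⟩
  s * ∑ m (λ x → t * ∑ m (f x))     ≡⟨ cong (s *_) (*-distribˡ-sum {m} t (λ i → ∑ m (f (toℕ i)))) ⟨
  s * (t * ∑ m (λ x → ∑ m (f x)))   ∎
  where open ≡-Reasoning

module _ (pr : Prime p) where

  private instance _ = prime⇒nonZero pr

  module _ (a b : ℤ) where

    private
      a′ = a ℤ.* + (p ^ 4)
      b′ = b ℤ.* + (p ^ 6)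

    scaled-on : ∀ k x y →
      ⟦ (+ p ∣? + (x * p ^ 2)) ×-dec on? (p ^ (6 + k)) a′ b′ (x * p ^ 2) (y * p ^ 3) ⟧ ≡ ⟦ on? (p ^ k) a b x y ⟧
    scaled-on k x y = ⟦⟧-cong
      (λ (_ , on) → *-cancelʳ-∣ (+ (p ^ 6)) {{ℕ.m^n≢0 p 6}} (subst₂ _∣_ p^6+k (F-scale p a b x y) on))
      (λ on → ∣ᵤ⇒∣ (ℕ.∣n⇒∣m*n x (ℕ.m∣m*n (p ^ 1))) ,
              subst₂ _∣_ (sym p^6+k) (sym (F-scale p a b x y)) (*-monoˡ-∣ (+ (p ^ 6)) on))
      ((+ p ∣? + (x * p ^ 2)) ×-dec on? (p ^ (6 + k)) a′ b′ (x * p ^ 2) (y * p ^ 3)) (on? (p ^ k) a b x y)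
      where
      p^6+k : + (p ^ (6 + k)) ≡ + (p ^ k) ℤ.* + (p ^ 6)
      p^6+k = trans (cong +_ (trans (ℕ.^-distribˡ-+-* p 6 k) (ℕ.*-comm (p ^ 6) (p ^ k)))) (ℤ.pos-* (p ^ k) (p ^ 6))

    -- After `x = p² X` and `y = p³ Y`, the ranges of `X` and `Y` have lengths `p ^ (4 + k)` and
    -- `p ^ (3 + k)`, while the condition has period `p ^ k` in each: hence `p⁴` times `p³`.
    singularPoints-scale : ∀ k → singularPoints p (p ^ (6 + k)) a′ b′ ≡ p ^ 7 * N p k a b
    singularPoints-scale k = begin
      singularPoints p (p ^ (6 + k)) a′ b′
        ≡⟨ singularPoints-multiples pr (n∣m*n (+ (p ^ 4)) a) (n∣m*n (+ (p ^ 6)) b) (6 + k) (4 + k) (3 + k) 2 3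
             (cong (λ n → 4 + n) (ℕ.+-comm 2 k)) (cong (λ n → 3 + n) (ℕ.+-comm 3 k))
             (λ x y p∣x on → p²∣x pr (n∣m*n (+ (p ^ 4)) a) (n∣m*n (+ (p ^ 6)) b) {6 + k} x y p∣x on (ℕ.m≤m+n 4 (2 + k)) ,
                             p³∣y pr (n∣m*n (+ (p ^ 4)) a) (n∣m*n (+ (p ^ 6)) b) {6 + k} x y p∣x on (ℕ.m≤m+n 5 (1 + k))) ⟩
      ∑ (p ^ (4 + k)) (λ x → ∑ (p ^ (3 + k)) (λ y →
        ⟦ (+ p ∣? + (x * p ^ 2)) ×-dec on? (p ^ (6 + k)) a′ b′ (x * p ^ 2) (y * p ^ 3) ⟧))
        ≡⟨ ∑-cong (p ^ (4 + k)) (λ x _ → ∑-cong (p ^ (3 + k)) (λ y _ → scaled-on k x y)) ⟩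
      ∑ (p ^ (4 + k)) (λ x → ∑ (p ^ (3 + k)) (λ y → ⟦ on? (p ^ k) a b x y ⟧))
        ≡⟨ cong₂ (λ m n → ∑ m (λ x → ∑ n (λ y → ⟦ on? (p ^ k) a b x y ⟧)))
             (ℕ.^-distribˡ-+-* p 4 k) (ℕ.^-distribˡ-+-* p 3 k) ⟩
      ∑ (p ^ 4 * p ^ k) (λ x → ∑ (p ^ 3 * p ^ k) (λ y → ⟦ on? (p ^ k) a b x y ⟧))
        ≡⟨ ∑∑-periodic (p ^ 4) (p ^ 3) (p ^ k) (λ x y → ⟦ on? (p ^ k) a b x y ⟧)
             (λ q x y → let (to , from) = ∣F-shiftˣ a b (p ^ k) y q x in
               ⟦⟧-cong to from (on? (p ^ k) a b (q * p ^ k + x) y) (on? (p ^ k) a b x y))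
             (λ q x y → let (to , from) = ∣F-shiftʸ a b (p ^ k) x q y in
               ⟦⟧-cong to from (on? (p ^ k) a b x (q * p ^ k + y)) (on? (p ^ k) a b x y)) ⟩
      p ^ 4 * (p ^ 3 * ∑ (p ^ k) (λ x → ∑ (p ^ k) (λ y → ⟦ on? (p ^ k) a b x y ⟧)))
        ≡⟨ cong (λ n → p ^ 4 * (p ^ 3 * n)) (N-∑ p k a b) ⟨
      p ^ 4 * (p ^ 3 * N p k a b)
        ≡⟨ ℕ.*-assoc (p ^ 4) (p ^ 3) (N p k a b) ⟨
      p ^ 4 * p ^ 3 * N p k a b
        ≡⟨ cong (_* N p k a b) (ℕ.^-distribˡ-+-* p 4 3) ⟨
      p ^ 7 * N p k a b ∎
      where open ≡-Reasoning

  module _ (2<p : 2 < p) where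

    p∣p^ : ∀ n → + p ∣ + (p ^ suc n)
    p∣p^ n = ∣ᵤ⇒∣ (ℕ.m∣m*n (p ^ n))

    N-scale : ∀ k a b → N p (6 + k) (a ℤ.* + (p ^ 4)) (b ℤ.* + (p ^ 6)) ≡ (p ∸ 1) * p ^ (5 + k) + p ^ 7 * N p k a b
    N-scale k a b = trans (N-split p (6 + k) (a ℤ.* + (p ^ 4)) (b ℤ.* + (p ^ 6))) (cong₂ _+_
      (unitPoints-^ pr 2<p (∣n⇒∣m*n a (p∣p^ 3)) (∣n⇒∣m*n b (p∣p^ 5)) (5 + k))
      (singularPoints-scale a b k))

    N-base : ∀ {a b} → + (p ^ 4) ∣ a → + (p ^ 6) ∣ b → ∀ j → 1 ≤ j → j < 6 → N p j a b ≡ baseValue p j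
    N-base {a} {b} p⁴∣a p⁶∣b j@(suc j-1) 1≤j j<6 = trans (N-split p j a b) (cong₂ _+_
      (unitPoints-^ pr 2<p (∣-trans (p∣p^ 3) p⁴∣a) (∣-trans (p∣p^ 5) p⁶∣b) j-1)
      (singularPoints-M pr p⁴∣a p⁶∣b j 1≤j j<6))

    -- The closed form multiplied by p, with pᵏ moved to the left: truncated subtraction does not
    -- occur, and k = 0 needs no separate treatment.
    N-iterate : ∀ t ℓ {k a b A B} → k ≡ 6 * t + ℓ → A ≡ a ℤ.* + (p ^ (4 * t)) → B ≡ b ℤ.* + (p ^ (6 * t)) →
                p * N p k A B + p ^ k ≡ p ^ (k + t) + p * (p ^ (7 * t) * N p ℓ a b)
    N-iterate zero ℓ {a = a} {b} refl refl refl
      rewrite ℤ.*-identityʳ a | ℤ.*-identityʳ b | ℕ.+-identityʳ ℓ | ℕ.+-identityʳ (N p ℓ a b) = ℕ.+-comm _ (p ^ ℓ)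
    N-iterate (suc t) ℓ {k} {a} {b} {A} {B} k≡ A≡ B≡ = begin
      p * N p k A B + p ^ k
        ≡⟨ cong₂ (λ n e → p * n + p ^ e) (trans (cong (λ k → N p k A B) k≡6+k′)
             (trans (cong₂ (N p (6 + k′)) A≡A′p⁴ B≡B′p⁶) (N-scale k′ A′ B′))) k≡6+k′ ⟩
      -- Adding `p ^ k` makes the recurrence homogeneous: `S k = p * N + p ^ k` satisfies
      -- `S (6 + k′) = p ^ 7 * S k′`, because `p (p - 1) Z + p Z = p² Z` and `p² Z = p ^ (7 + k′)`.
      p * ((p ∸ 1) * Z + p ^ 7 * N′) + p * Z
        ≡⟨ regroup p Z (p ^ 7) N′ ⟩
      p ^ 7 * (p * N′) + p * (p * Z)
        ≡⟨ cong (λ z → p ^ 7 * (p * N′) + z) (ℕ.^-distribˡ-+-* p 7 k′) ⟩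
      p ^ 7 * (p * N′) + p ^ 7 * p ^ k′
        ≡⟨ ℕ.*-distribˡ-+ (p ^ 7) (p * N′) (p ^ k′) ⟨
      p ^ 7 * (p * N′ + p ^ k′)
        ≡⟨ cong (p ^ 7 *_) (N-iterate t ℓ refl refl refl) ⟩
      p ^ 7 * (p ^ (k′ + t) + p * (p ^ (7 * t) * N p ℓ a b))
        ≡⟨ solveℕ 5 (λ s e p r n → s ⊗ (e ⊕ p ⊗ (r ⊗ n)) ⊜ s ⊗ e ⊕ p ⊗ (s ⊗ r ⊗ n)) refl
             (p ^ 7) (p ^ (k′ + t)) p (p ^ (7 * t)) (N p ℓ a b) ⟩
      p ^ 7 * p ^ (k′ + t) + p * (p ^ 7 * p ^ (7 * t) * N p ℓ a b)
        ≡⟨ cong₂ (λ u v → u + p * (v * N p ℓ a b)) (ℕ.^-distribˡ-+-* p 7 (k′ + t)) (^-*-suc 7) ⟨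
      p ^ (7 + (k′ + t)) + p * (p ^ (7 * suc t) * N p ℓ a b)
        ≡⟨ cong (λ e → p ^ e + p * (p ^ (7 * suc t) * N p ℓ a b)) exponent ⟩
      p ^ (k + suc t) + p * (p ^ (7 * suc t) * N p ℓ a b) ∎
      where
      open ≡-Reasoning
      k′ = 6 * t + ℓ
      A′ = a ℤ.* + (p ^ (4 * t))
      B′ = b ℤ.* + (p ^ (6 * t))
      N′ = N p k′ A′ B′
      Z  = p ^ (5 + k′)

      k≡6+k′ : k ≡ 6 + k′
      k≡6+k′ = trans k≡ (cong (_+ ℓ) (ℕ.*-suc 6 t))

      ^-*-suc : ∀ d → p ^ (d * suc t) ≡ p ^ d * p ^ (d * t)
      ^-*-suc d = trans (cong (p ^_) (ℕ.*-suc d t)) (ℕ.^-distribˡ-+-* p d (d * t))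

      peel : ∀ c d → c ℤ.* + (p ^ (d * suc t)) ≡ c ℤ.* + (p ^ (d * t)) ℤ.* + (p ^ d)
      peel c d = trans (cong (λ z → c ℤ.* z) 
        (trans (cong +_ (trans (^-*-suc d) (ℕ.*-comm (p ^ d) (p ^ (d * t))))) (ℤ.pos-* (p ^ (d * t)) (p ^ d))))
                       (sym (ℤ.*-assoc c (+ (p ^ (d * t))) (+ (p ^ d))))

      A≡A′p⁴ : A ≡ A′ ℤ.* + (p ^ 4)
      A≡A′p⁴ = trans A≡ (peel a 4)

      B≡B′p⁶ : B ≡ B′ ℤ.* + (p ^ 6)
      B≡B′p⁶ = trans B≡ (peel b 6)

      exponent : 7 + (k′ + t) ≡ k + suc t
      exponent = trans (cong suc (cong (_+ t) (sym k≡6+k′))) (sym (ℕ.+-suc k t))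

      regroup : ∀ p .{{_ : NonZero p}} Z s n → p * ((p ∸ 1) * Z + s * n) + p * Z ≡ s * (p * n) + p * (p * Z)
      regroup (suc p) Z s n = solveℕ 4 (λ p Z s n → (conℕ 1 ⊕ p) ⊗ (p ⊗ Z ⊕ s ⊗ n) ⊕ (conℕ 1 ⊕ p) ⊗ Z
        ⊜ s ⊗ ((conℕ 1 ⊕ p) ⊗ n) ⊕ (conℕ 1 ⊕ p) ⊗ ((conℕ 1 ⊕ p) ⊗ Z)) refl p Z s n

    -- As `k` is positive, `p ^ k` is `p * Z`, so the factor `p` and then the summand `Z` cancel
    -- from `N-iterate`.
    N-closed-form : ∀ t ℓ {k a b A B} → 1 ≤ k → k ≡ 6 * t + ℓ → A ≡ a ℤ.* + (p ^ (4 * t)) → B ≡ b ℤ.* + (p ^ (6 * t)) →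
                    N p k A B ≡ p ^ (k ∸ 1) * (p ^ t ∸ 1) + p ^ (7 * t) * N p ℓ a b
    N-closed-form t ℓ {k@(suc k-1)} {a} {b} {A} {B} _ k≡ A≡ B≡ =
      ℕ.+-cancelʳ-≡ Z _ _ (ℕ.*-cancelˡ-≡ _ _ p (begin
        p * (N p k A B + Z)            ≡⟨ ℕ.*-distribˡ-+ p (N p k A B) Z ⟩
        p * N p k A B + p ^ k          ≡⟨ N-iterate t ℓ k≡ A≡ B≡ ⟩
        p * p ^ (k-1 + t) + p * R      ≡⟨ ℕ.*-distribˡ-+ p _ R ⟨
        p * (p ^ (k-1 + t) + R)        ≡⟨ cong (λ z → p * (z + R)) (ℕ.^-distribˡ-+-* p k-1 t) ⟩
        p * (Z * p ^ t + R)            ≡⟨ cong (p *_) (split (p ^ t) {{ℕ.m^n≢0 p t}}) ⟩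
        p * (Z * (p ^ t ∸ 1) + R + Z)  ∎))
      where
      open ≡-Reasoning
      Z = p ^ k-1
      R = p ^ (7 * t) * N p ℓ a b
      -- `p ^ t` is nonzero, so `p ^ t ∸ 1` is a true difference.
      split : ∀ q .{{_ : NonZero q}} → Z * q + R ≡ Z * (q ∸ 1) + R + Z
      split (suc q) = solveℕ 3 (λ Z q R → Z ⊗ (conℕ 1 ⊕ q) ⊕ R ⊜ Z ⊗ q ⊕ R ⊕ Z) refl Z q R

-- Valuations and the terminal cases

e<p^e : 2 ≤ p → ∀ e → e < p ^ e
e<p^e 2≤p zero    = s≤s z≤n
e<p^e {p} 2≤p (suc e) = begin-strict
  suc e          <⟨ s≤s (e<p^e 2≤p e) ⟩
  1 + p ^ e      ≤⟨ ℕ.+-monoˡ-≤ (p ^ e) (ℕ.≤-trans (s≤s z≤n) (e<p^e 2≤p e)) ⟩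
  p ^ e + p ^ e  ≡⟨ cong (λ n → p ^ e + n) (ℕ.+-identityʳ (p ^ e)) ⟨
  2 * p ^ e      ≤⟨ ℕ.*-monoˡ-≤ (p ^ e) 2≤p ⟩
  p * p ^ e      ∎
  where open ℕ.≤-Reasoning

≤-maxPower : ∀ n bound {e} → e ≤ bound → + (p ^ e) ∣ n → e ≤ maxPower p n bound
≤-maxPower     n zero    e≤0 _ = e≤0
≤-maxPower {p} n (suc d) {e} e≤1+d p^e∣n with + (p ^ suc d) ∣? n
... | yes _   = e≤1+d
... | no p∤n with ℕ.m≤n⇒m<n∨m≡n e≤1+d
...   | inj₁ (s≤s e≤d) = ≤-maxPower n d e≤d p^e∣n
...   | inj₂ refl      = contradiction p^e∣n p∤n

≤⁺v⇒∣ : ∀ n {e} → [ e ] ≤⁺ v p n → + (p ^ e) ∣ n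
≤⁺v⇒∣     (+ zero)     _       = divides (+ 0) refl
≤⁺v⇒∣ {p} n@(+ suc _)  [ e≤v ] = ∣-trans (^-∣ p e≤v) (maxPower-∣ p n ℤ.∣ n ∣)
≤⁺v⇒∣ {p} n@(-[1+ _ ]) [ e≤v ] = ∣-trans (^-∣ p e≤v) (maxPower-∣ p n ℤ.∣ n ∣)

-- For nonzero `n`, `e < p ^ e ≤ ∣ n ∣` puts `e` within the search range of `maxPower`.
∣⇒≤⁺v : 2 ≤ p → ∀ n {e} → + (p ^ e) ∣ n → [ e ] ≤⁺ v p n
∣⇒≤⁺v 2≤p (+ zero)             _     = _ ≤⊤⁺
∣⇒≤⁺v 2≤p n@(+ suc _)  {e} p^e∣n = [ ≤-maxPower n ℤ.∣ n ∣ (ℕ.≤-trans (ℕ.<⇒≤ (e<p^e 2≤p e)) (ℕ.∣⇒≤ (∣⇒∣ᵤ p^e∣n))) p^e∣n ]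
∣⇒≤⁺v 2≤p n@(-[1+ _ ]) {e} p^e∣n = [ ≤-maxPower n ℤ.∣ n ∣ (ℕ.≤-trans (ℕ.<⇒≤ (e<p^e 2≤p e)) (ℕ.∣⇒≤ (∣⇒∣ᵤ p^e∣n))) p^e∣n ]

≤⇒≤/ : ∀ d .{{_ : NonZero d}} {q m} → d * q ≤ m → q ≤ m / d
≤⇒≤/ d {q} {m} dq≤m = subst (_≤ m / d) (trans (cong (_/ d) (ℕ.*-comm d q)) (m*n/n≡m q d)) (/-monoˡ-≤ d dq≤m)

≤⁺⇒≤⁺⌊/⌋ : ∀ d .{{_ : NonZero d}} {q x} → [ d * q ] ≤⁺ x → [ q ] ≤⁺ ⌊ x / d ⌋
≤⁺⇒≤⁺⌊/⌋ d [ dq≤m ]  = [ ≤⇒≤/ d dq≤m ]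
≤⁺⇒≤⁺⌊/⌋ d (_ ≤⊤⁺) = _ ≤⊤⁺

⊓∞-glb : ∀ {x q n} → [ q ] ≤⁺ x → q ≤ n → q ≤ x ⊓∞ n
⊓∞-glb [ q≤m ]  q≤n = ℕ.⊓-glb q≤m q≤n
⊓∞-glb (_ ≤⊤⁺) q≤n = q≤n

*-pres-∣^ : ∀ p d t {A} a → A ≡ a ℤ.* + (p ^ (d * t)) → + (p ^ d) ∣ a → + (p ^ (d * suc t)) ∣ A
*-pres-∣^ p d t a refl p^d∣a = subst (_∣ a ℤ.* + (p ^ (d * t)))
  (trans (sym (ℤ.pos-* (p ^ d) (p ^ (d * t)))) 
    (cong +_ (trans (sym (ℕ.^-distribˡ-+-* p d (d * t))) (cong (p ^_) (sym (ℕ.*-suc d t))))))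
  (*-monoˡ-∣ (+ (p ^ (d * t))) p^d∣a)

-- If both divisibilities held, t + 1 would be a lower bound of the three terms whose minimum is t.
scalingDepth-maximal : 2 ≤ p → ∀ k A B → let t = scalingDepth p k A B in 6 ≤ k ∸ 6 * t →
                       ¬ (+ (p ^ 4) ∣ scaledA p k A B × + (p ^ 6) ∣ scaledB p k A B)
scalingDepth-maximal {p} 2≤p k A B 6≤ℓ (p⁴∣Aₜ , p⁶∣Bₜ) = ℕ.1+n≰n (⊓∞-glb
  (deeper 4 A (scaledA p k A B) (_∣_.equality (p⁴ᵗ∣A p k A B)) p⁴∣Aₜ) (⊓∞-glb
  (deeper 6 B (scaledB p k A B) (_∣_.equality (p⁶ᵗ∣B p k A B)) p⁶∣Bₜ)
  (≤⇒≤/ 6 6[1+t]≤k)))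
  where
  t = scalingDepth p k A B
  deeper : ∀ d .{{_ : NonZero d}} n m → n ≡ m ℤ.* + (p ^ (d * t)) → + (p ^ d) ∣ m → [ suc t ] ≤⁺ ⌊ v p n / d ⌋
  deeper d n m n≡ p^d∣m = ≤⁺⇒≤⁺⌊/⌋ d (∣⇒≤⁺v 2≤p n (*-pres-∣^ p d t m n≡ p^d∣m))
  6[1+t]≤k : 6 * suc t ≤ k
  6[1+t]≤k = begin
    6 * suc t              ≡⟨ ℕ.*-suc 6 t ⟩
    6 + 6 * t              ≤⟨ ℕ.+-monoˡ-≤ (6 * t) 6≤ℓ ⟩
    (k ∸ 6 * t) + 6 * t    ≡⟨ ℕ.m∸n+n≡m (6*t≤k p k A B) ⟩
    k                      ∎
    where open ℕ.≤-Reasoning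

-- `p` divides `D - 4a³ = 27 b²`, and `27 = 3 ^ 3` is prime to `p` because `p > 3`.
prime∣D∧∣a⇒∣b : Prime p → 3 < p → ∀ a b → + p ∣ D a b → + p ∣ a → + p ∣ b
prime∣D∧∣a⇒∣b {p} pr 3<p a b p∣D p∣a =
  [ (λ p∣27 → contradiction (ℕ.∣⇒≤ (prime∣^ pr 3 {3} (∣⇒∣ᵤ p∣27))) (ℕ.<⇒≱ 3<p))
  , p∣x²⇒p∣x pr b ∘ subst (λ z → + p ∣ b ℤ.* z) (ℤ.*-identityʳ b) ]′
  (euclid pr (+ 27) (b ℤ.^ 2) (∣m+n∣m⇒∣n {m = + 4 ℤ.* a ℤ.^ 3} p∣D (∣n⇒∣m*n (+ 4) (∣m⇒∣m*n (a ℤ.^ 2) p∣a))))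

-- Independent of the exponent, so one dichotomy serves both ranges of `ℓ`: below 6 its second
-- alternative yields a base value, from 6 on maximality of `t` excludes it.
terminal-or-scalable : Prime p → 3 < p → ∀ a b → TerminalCase p a b ⊎ (+ (p ^ 4) ∣ a × + (p ^ 6) ∣ b)
terminal-or-scalable {p} pr 3<p a b with + p ∣? D a b | + p ∣? a
... | no p∤D  | _       = inj₁ (inj₁ p∤D)
... | yes p∣D | no p∤a  = inj₁ (inj₂ (inj₁ (p∣D , p∤a)))
... | yes p∣D | yes p∣a with + (p ^ 4) ∣? a | + (p ^ 6) ∣? b
...   | yes p⁴∣a | yes p⁶∣b = inj₂ (p⁴∣a , p⁶∣b)
...   | no p⁴∤a  | _        = inj₁ (inj₂ (inj₂ (p∣a , prime∣D∧∣a⇒∣b pr 3<p a b p∣D p∣a , p⁴∤a ∘ ≤⁺v⇒∣ a ∘ proj₁)))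
...   | yes _    | no p⁶∤b  = inj₁ (inj₂ (inj₂ (p∣a , prime∣D∧∣a⇒∣b pr 3<p a b p∣D p∣a , p⁶∤b ∘ ≤⁺v⇒∣ b ∘ proj₂)))

¬×⇒¬⊎¬ : Dec P → ¬ (P × Q) → ¬ P ⊎ ¬ Q
¬×⇒¬⊎¬ (yes p) ¬pq = inj₂ (λ q → ¬pq (p , q))
¬×⇒¬⊎¬ (no ¬p) ¬pq = inj₁ ¬p

theorem15 : (p : ℕ) → Prime p → 5 ≤ p →
  (k : ℕ) → 1 ≤ k → (A B : ℤ) →
  let t  = scalingDepth p k A B
      ℓ  = k ∸ 6 * t
      Aₜ = scaledA p k A B
      Bₜ = scaledB p k A B
  in
  (N p k A B ≡ p ^ (k ∸ 1) * (p ^ t ∸ 1) + p ^ (7 * t) * N p ℓ Aₜ Bₜ)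
  × (ℓ ≡ 0 → N p ℓ Aₜ Bₜ ≡ 1)
  × (1 ≤ ℓ → ℓ < 6 →
      TerminalCase p Aₜ Bₜ
      ⊎ (+ (p ^ 4) ∣ Aₜ × + (p ^ 6) ∣ Bₜ × N p ℓ Aₜ Bₜ ≡ baseValue p ℓ))
  × (6 ≤ ℓ →
      (¬ (+ (p ^ 4) ∣ Aₜ) ⊎ ¬ (+ (p ^ 6) ∣ Bₜ))
      × ¬ ScalingAvailable p ℓ Aₜ Bₜ
      × TerminalCase p Aₜ Bₜ)
theorem15 p pr 5≤p k 1≤k A B =
    N-closed-form pr 2<p t ℓ 1≤k (sym (ℕ.m+[n∸m]≡n (6*t≤k p k A B)))
      (_∣_.equality (p⁴ᵗ∣A p k A B)) (_∣_.equality (p⁶ᵗ∣B p k A B))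
  -- `N p zero` computes to 1.
  , (λ ℓ≡0 → cong (λ j → N p j Aₜ Bₜ) ℓ≡0)
  , (λ 1≤ℓ ℓ<6 → map₂ (λ (p⁴∣Aₜ , p⁶∣Bₜ) → p⁴∣Aₜ , p⁶∣Bₜ , N-base pr 2<p p⁴∣Aₜ p⁶∣Bₜ ℓ 1≤ℓ ℓ<6) dichotomy)
  , λ 6≤ℓ → let unscalable = scalingDepth-maximal (ℕ.<⇒≤ 2<p) k A B 6≤ℓ in
      ¬×⇒¬⊎¬ (+ (p ^ 4) ∣? Aₜ) unscalable
    , unscalable ∘ proj₂
    , [ id , (λ scalable → contradiction scalable unscalable) ]′ dichotomy
  where
  t  = scalingDepth p k A B
  ℓ  = k ∸ 6 * t
  Aₜ = scaledA p k A B
  Bₜ = scaledB p k A B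
  2<p : 2 < p
  2<p = ℕ.≤-trans (ℕ.m≤m+n 3 2) 5≤p
  dichotomy : TerminalCase p Aₜ Bₜ ⊎ (+ (p ^ 4) ∣ Aₜ × + (p ^ 6) ∣ Bₜ)
  dichotomy = terminal-or-scalable pr (ℕ.≤-trans (ℕ.n≤1+n 4) 5≤p) Aₜ Bₜ
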